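{- Let $\Phi=(G,\varphi)$ be a $\mathbb{T}$-gain graph on a connected graph $G$ with maximum vertex degree $\Delta$. Then $\rho(A(\Phi))=\Delta$ if and only if $G$ is $\Delta$-regular and either $\Phi$ or $-\Phi$ is balanced.
   Context: Graphs are finite, simple and undirected. $\mathbb{T}=\{z\in\mathbb{C}:|z|=1\}$. A $\mathbb{T}$-gain on $G$ is a map $\varphi$ from oriented edges to $\mathbb{T}$ with $\varphi(\overrightarrow{e_{ts}})=\varphi(\overrightarrow{e_{st}})^{ -1}$; $A(\Phi)$ is the Hermitian matrix with $(s,t)$ entry $\varphi(\overrightarrow{e_{st}})$ if $v_s\sim v_t$, else $0$; $\rho$ is the spectral radius. $-\Phi$ denotes the gain graph $(G,-\varphi)$. The gain of a directed cycle is the product of the gains of its oriented edges; $\Phi$ is balanced if every directed cycle has gain $1$. -}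

module Defs where

open import Data.Bool.Base using (if_then_else_)
open import Data.Fin.Base using (Fin)
import Data.Integer.Base as ℤ
import Data.Integer.Properties as ℤ
open import Data.List.Base using (List; []; _∷_; length; map; filter; allFin)
open import Data.List.Extrema.Nat using (max)
open import Data.List.Relation.Unary.Unique.Propositional using (Unique)
open import Data.Nat.Base as ℕ using (ℕ; zero; suc)
import Data.Nat.Properties as ℕ
open import Data.Product.Base using (∃-syntax; Σ-syntax; _×_; _,_; proj₁; proj₂)
open import Data.Rational.Base as ℚ using (ℚ; 0ℚ; 1ℚ; ½; ↥_; ↧ₙ_)
import Data.Rational.Properties as ℚ
import Data.Rational.Unnormalised.Base as ℚᵘ
import Data.Rational.Unnormalised.Properties as ℚᵘ
open import Data.Rational.Solver using (module +-*-Solver)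
open import Data.Sum.Base using (_⊎_; inj₁; inj₂)
import Data.Vec.Functional as Vector
open import Data.Vec.Functional using (Vector)
open import Level using (0ℓ)
open import Relation.Binary.Construct.Closure.ReflexiveTransitive using (Star; ε; _◅_)
open import Relation.Binary.Core using (Rel)
open import Relation.Binary.Definitions using (Decidable; Irreflexive; Symmetric)
open import Relation.Binary.PropositionalEquality
  using (_≡_; refl; sym; trans; cong; cong₂; subst; subst₂)
open import Relation.Nullary using (¬_; Dec; does; yes; no)

private
  variable
    n : ℕ

------------------------------------------------------------------------

module _ where
  open import Data.Rational.Base using (_+_; _*_; -_; _-_; _≤_; _<_; ∣_∣)
  open ℚ.≤-Reasoning
  open +-*-Solver using (solve; _:=_; _:+_; _:*_; _:-_; :-_; con)

  p≤∣p∣ : ∀ p → p ≤ ∣ p ∣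
  p≤∣p∣ p with ℚ.≤-total 0ℚ p
  ... | inj₁ 0≤p = ℚ.≤-reflexive (sym (ℚ.0≤p⇒∣p∣≡p 0≤p))
  ... | inj₂ p≤0 = ℚ.≤-trans p≤0 (ℚ.0≤∣p∣ p)

  ∣p-q∣≤r⇒p≤q+r : ∀ {p q r} → ∣ p - q ∣ ≤ r → p ≤ q + r
  ∣p-q∣≤r⇒p≤q+r {p} {q} {r} h = begin
    p              ≡⟨ solve 2 (λ p q → p := q :+ (p :- q)) refl p q ⟩
    q + (p - q)    ≤⟨ ℚ.+-monoʳ-≤ q (ℚ.≤-trans (p≤∣p∣ (p - q)) h) ⟩
    q + r          ∎

  p≤q+r⇒p-q≤r : ∀ {p q r} → p ≤ q + r → p - q ≤ r
  p≤q+r⇒p-q≤r {p} {q} {r} h = begin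
    p - q          ≤⟨ ℚ.+-monoˡ-≤ (- q) h ⟩
    q + r - q      ≡⟨ solve 2 (λ q r → q :+ r :- q := r) refl q r ⟩
    r              ∎

  close : ∀ {p q r} → p ≤ q + r → q ≤ p + r → ∣ p - q ∣ ≤ r
  close {p} {q} {r} p≤ q≤ with ℚ.∣p∣≡p∨∣p∣≡-p (p - q)
  ... | inj₁ eq = ℚ.≤-trans (ℚ.≤-reflexive eq) (p≤q+r⇒p-q≤r p≤)
  ... | inj₂ eq = ℚ.≤-trans
    (ℚ.≤-reflexive (trans eq (solve 2 (λ p q → :- (p :- q) := q :- p) refl p q)))
    (p≤q+r⇒p-q≤r q≤)

  *-mono-≤ : ∀ {p q r s} → 0ℚ ≤ p → 0ℚ ≤ s → p ≤ q → r ≤ s → p * r ≤ q * s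
  *-mono-≤ {p} {q} {r} {s} 0≤p 0≤s p≤q r≤s = ℚ.≤-trans
    (ℚ.*-monoˡ-≤-nonNeg p {{ℚ.nonNegative 0≤p}} r≤s)
    (ℚ.*-monoʳ-≤-nonNeg s {{ℚ.nonNegative 0≤s}} p≤q)

  *-pos : ∀ {p q} → 0ℚ < p → 0ℚ < q → 0ℚ < p * q
  *-pos {p} {q} 0<p 0<q = ℚ.positive⁻¹ (p * q)
    {{ℚ.pos*pos⇒pos p {{ℚ.positive 0<p}} q {{ℚ.positive 0<q}}}}

  ½-pos : ∀ {p} → 0ℚ < p → 0ℚ < ½ * p
  ½-pos = *-pos (ℚ.positive⁻¹ ½)

  ½+½ : ∀ p → ½ * p + ½ * p ≡ p
  ½+½ = solve 1 (λ p → con ½ :* p :+ con ½ :* p := p) refl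

  +-nonNeg : ∀ {p q} → 0ℚ ≤ p → 0ℚ ≤ q → 0ℚ ≤ p + q
  +-nonNeg 0≤p 0≤q = ℚ.≤-trans (ℚ.≤-reflexive (sym (ℚ.+-identityʳ 0ℚ))) (ℚ.+-mono-≤ 0≤p 0≤q)

  *-nonNeg : ∀ {p q} → 0ℚ ≤ p → 0ℚ ≤ q → 0ℚ ≤ p * q
  *-nonNeg {p} {q} 0≤p 0≤q = ℚ.nonNegative⁻¹ (p * q)
    {{ℚ.nonNeg*nonNeg⇒nonNeg p {{ℚ.nonNegative 0≤p}} q {{ℚ.nonNegative 0≤q}}}}

  *-mono-< : ∀ {p q} → 0ℚ ≤ p → p < q → p * p < q * q
  *-mono-< {p} {q} 0≤p p<q = ℚ.≤-<-trans
    (ℚ.*-monoˡ-≤-nonNeg p {{ℚ.nonNegative 0≤p}} (ℚ.<⇒≤ p<q))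
    (ℚ.*-monoˡ-<-pos q {{ℚ.positive (ℚ.≤-<-trans 0≤p p<q)}} p<q)

fromℕ : ℕ → ℚ
fromℕ zero    = 0ℚ
fromℕ (suc n) = fromℕ n ℚ.+ 1ℚ

1/1+ : ℕ → ℚ
1/1+ n = ℤ.+ 1 ℚ./ suc n

------------------------------------------------------------------------

grid : ℕ → ℕ → ℚ
grid n k = fromℕ k ℚ.* 1/1+ n

-- The largest k ≤ b with (k/(1+n))² ≤ q, or 0 if there is none.
root : ℕ → ℚ → ℕ → ℕ
root n q zero    = zero
root n q (suc b) =
  if does (grid n (suc b) ℚ.* grid n (suc b) ℚ.≤? q) then suc b else root n q b

-- √q rounded down to a multiple of 1/(1+n), for q ≥ 0.
-- The bound (1+n)∣↥ q∣ is large enough because q ≤ ∣↥ q∣ ≤ ∣↥ q∣².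
√ℚ : ℕ → ℚ → ℚ
√ℚ n q = grid n (root n q (suc n ℕ.* ℤ.∣ ↥ q ∣))

module _ where
  open import Data.Rational.Base using (_+_; _*_; -_; _-_; _≤_; _<_; ∣_∣)
  open ℚ.≤-Reasoning
  open +-*-Solver using (solve; _:=_; _:+_; _:*_; _:-_; :-_; con)

  fromℕ-nonNeg : ∀ n → 0ℚ ≤ fromℕ n
  fromℕ-nonNeg zero    = ℚ.≤-refl
  fromℕ-nonNeg (suc n) = +-nonNeg (fromℕ-nonNeg n) (ℚ.nonNegative⁻¹ 1ℚ)

  fromℕ-+ : ∀ m n → fromℕ (m ℕ.+ n) ≡ fromℕ m + fromℕ n
  fromℕ-+ zero    n = sym (ℚ.+-identityˡ (fromℕ n))
  fromℕ-+ (suc m) n = trans (cong (_+ 1ℚ) (fromℕ-+ m n))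
    (solve 2 (λ a b → a :+ b :+ con 1ℚ := a :+ con 1ℚ :+ b) refl (fromℕ m) (fromℕ n))

  fromℕ-* : ∀ m n → fromℕ (m ℕ.* n) ≡ fromℕ m * fromℕ n
  fromℕ-* zero    n = sym (ℚ.*-zeroˡ (fromℕ n))
  fromℕ-* (suc m) n = trans (fromℕ-+ n (m ℕ.* n)) (trans (cong (fromℕ n +_) (fromℕ-* m n))
    (solve 2 (λ a b → b :+ a :* b := (a :+ con 1ℚ) :* b) refl (fromℕ m) (fromℕ n)))

  toℚᵘ-fromℕ : ∀ n → ℚ.toℚᵘ (fromℕ n) ℚᵘ.≃ ℚᵘ.mkℚᵘ (ℤ.+ n) 0
  toℚᵘ-fromℕ zero    = ℚᵘ.≃-refl
  toℚᵘ-fromℕ (suc n) = ℚᵘ.≃-trans (ℚ.toℚᵘ-homo-+ (fromℕ n) 1ℚ)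
    (ℚᵘ.≃-trans (ℚᵘ.+-congˡ (ℚ.toℚᵘ 1ℚ) (toℚᵘ-fromℕ n))
      (ℚᵘ.*≡* (cong (ℤ._* ℤ.1ℤ)
        (trans (cong (ℤ._+ ℤ.1ℤ) (ℤ.*-identityʳ (ℤ.+ n))) (cong ℤ.+_ (ℕ.+-comm n 1))))))

  toℚᵘ-1/1+ : ∀ n → ℚ.toℚᵘ (1/1+ n) ℚᵘ.≃ ℚᵘ.mkℚᵘ (ℤ.+ 1) n
  toℚᵘ-1/1+ n = ℚ.toℚᵘ-fromℚᵘ (ℚᵘ.mkℚᵘ (ℤ.+ 1) n)

  1/1+-nonNeg : ∀ n → 0ℚ ≤ 1/1+ n
  1/1+-nonNeg n = ℚ.nonNegative⁻¹ (1/1+ n) {{ℚ.normalize-nonNeg 1 (suc n)}}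

  1/1+-inverse : ∀ n → fromℕ (suc n) * 1/1+ n ≡ 1ℚ
  1/1+-inverse n = ℚ.toℚᵘ-injective (ℚᵘ.≃-trans (ℚ.toℚᵘ-homo-* (fromℕ (suc n)) (1/1+ n))
    (ℚᵘ.≃-trans (ℚᵘ.*-cong (toℚᵘ-fromℕ (suc n)) (toℚᵘ-1/1+ n))
      (ℚᵘ.*≡* (trans (ℤ.*-identityʳ _) (trans (ℤ.*-identityʳ (ℤ.+ suc n))
        (sym (trans (ℤ.*-identityˡ _) (ℤ.*-identityˡ (ℤ.+ suc n)))))))))

  1/1+-small : ∀ {n e} → 0ℚ < e → ↧ₙ e ℕ.≤ n → 1/1+ n ≤ e
  1/1+-small {n} {e@record{}} 0<e d≤n with ℚ.positive 0<e
  1/1+-small {n} {ℚ.mkℚ ℤ.+[1+ a ] d c} 0<e d≤n | _ =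
    ℚ.toℚᵘ-cancel-≤ (ℚᵘ.≤-respˡ-≃ (ℚᵘ.≃-sym (toℚᵘ-1/1+ n)) (ℚᵘ.*≤* (ℤ.+≤+
      (ℕ.≤-trans (ℕ.≤-reflexive (ℕ.*-identityˡ (suc d)))
        (ℕ.≤-trans (ℕ.m≤n⇒m≤1+n d≤n) (ℕ.m≤m+n (suc n) (a ℕ.* suc n)))))))

  p≤fromℕ∣↥p∣ : ∀ p → p ≤ fromℕ ℤ.∣ ↥ p ∣
  p≤fromℕ∣↥p∣ p@(ℚ.mkℚ a d c) = ℚ.toℚᵘ-cancel-≤
    (ℚᵘ.≤-respʳ-≃ (ℚᵘ.≃-sym (toℚᵘ-fromℕ ℤ.∣ a ∣)) (ℚᵘ.*≤* (lemma a)))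
    where
    lemma : ∀ a → a ℤ.* ℤ.1ℤ ℤ.≤ ℤ.+ ℤ.∣ a ∣ ℤ.* ℤ.+ suc d
    lemma (ℤ.+ k) = subst₂ ℤ._≤_ (sym (ℤ.*-identityʳ (ℤ.+ k))) (ℤ.pos-* k (suc d))
      (ℤ.+≤+ (ℕ.m≤m*n k (suc d)))
    lemma ℤ.-[1+ k ] = ℤ.-≤+

  root-lower : ∀ n q b → let s = grid n (root n q b) in s ≡ 0ℚ ⊎ s * s ≤ q
  root-lower n q zero    = inj₁ (ℚ.*-zeroˡ (1/1+ n))
  root-lower n q (suc b) = go (grid n (suc b) * grid n (suc b) ℚ.≤? q)
    where
    go : (d : Dec (grid n (suc b) * grid n (suc b) ≤ q)) →
         let s = grid n (if does d then suc b else root n q b) in s ≡ 0ℚ ⊎ s * s ≤ q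
    go (yes s²≤q) = inj₂ s²≤q
    go (no  _)    = root-lower n q b

  root-upper : ∀ n q b → let t = grid n (suc b); s = grid n (suc (root n q b)) in
               q < t * t → q < s * s
  root-upper n q zero    q<t² = q<t²
  root-upper n q (suc b) q<t² = go (grid n (suc b) * grid n (suc b) ℚ.≤? q)
    where
    go : (d : Dec (grid n (suc b) * grid n (suc b) ≤ q)) →
         let s = grid n (suc (if does d then suc b else root n q b)) in q < s * s
    go (yes _)    = q<t²
    go (no  t²≰q) = root-upper n q b (ℚ.≰⇒> t²≰q)

  √ℚ-nonNeg : ∀ n q → 0ℚ ≤ √ℚ n q
  √ℚ-nonNeg n q = *-nonNeg (fromℕ-nonNeg (root n q (suc n ℕ.* ℤ.∣ ↥ q ∣))) (1/1+-nonNeg n)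

  √ℚ-lower : ∀ n q → √ℚ n q ≡ 0ℚ ⊎ √ℚ n q * √ℚ n q ≤ q
  √ℚ-lower n q = root-lower n q (suc n ℕ.* ℤ.∣ ↥ q ∣)

  1/1+-pos : ∀ n → 0ℚ < 1/1+ n
  1/1+-pos n = ℚ.positive⁻¹ (1/1+ n) {{ℚ.normalize-pos 1 (suc n)}}

  fromℕ≤fromℕ² : ∀ n → fromℕ n ≤ fromℕ n * fromℕ n
  fromℕ≤fromℕ² zero    = ℚ.≤-refl
  fromℕ≤fromℕ² (suc n) = begin
    fromℕ n + 1ℚ                       ≡⟨ ℚ.+-identityˡ (fromℕ n + 1ℚ) ⟨
    0ℚ + (fromℕ n + 1ℚ)                ≤⟨ ℚ.+-monoˡ-≤ (fromℕ n + 1ℚ)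
                                            (*-nonNeg (fromℕ-nonNeg n) (fromℕ-nonNeg (suc n))) ⟩
    fromℕ n * (fromℕ n + 1ℚ) + (fromℕ n + 1ℚ)
      ≡⟨ solve 1 (λ a → a :* (a :+ con 1ℚ) :+ (a :+ con 1ℚ) := (a :+ con 1ℚ) :* (a :+ con 1ℚ))
           refl (fromℕ n) ⟩
    (fromℕ n + 1ℚ) * (fromℕ n + 1ℚ)    ∎

  √ℚ-upper : ∀ n q → q < (√ℚ n q + 1/1+ n) * (√ℚ n q + 1/1+ n)
  √ℚ-upper n q = subst (λ s → q < s * s) (step (root n q b)) (root-upper n q b (begin-strict
    q                      ≤⟨ p≤fromℕ∣↥p∣ q ⟩
    fromℕ a                ≤⟨ fromℕ≤fromℕ² a ⟩
    fromℕ a * fromℕ a      <⟨ *-mono-< (fromℕ-nonNeg a) a<t ⟩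
    t * t                  ∎))
    where
    a = ℤ.∣ ↥ q ∣
    b = suc n ℕ.* a
    t = grid n (suc b)

    step : ∀ k → grid n (suc k) ≡ grid n k + 1/1+ n
    step k = solve 2 (λ x d → (x :+ con 1ℚ) :* d := x :* d :+ d) refl (fromℕ k) (1/1+ n)

    t≡ : fromℕ a + 1/1+ n ≡ t
    t≡ = sym (trans (step b) (cong (_+ 1/1+ n) (begin-equality
      fromℕ b * 1/1+ n                     ≡⟨ cong (_* 1/1+ n) (fromℕ-* (suc n) a) ⟩
      fromℕ (suc n) * fromℕ a * 1/1+ n     ≡⟨ solve 3 (λ x y z → x :* y :* z := y :* (x :* z)) refl
                                                (fromℕ (suc n)) (fromℕ a) (1/1+ n) ⟩
      fromℕ a * (fromℕ (suc n) * 1/1+ n)   ≡⟨ cong (fromℕ a *_) (1/1+-inverse n) ⟩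
      fromℕ a * 1ℚ                         ≡⟨ ℚ.*-identityʳ (fromℕ a) ⟩
      fromℕ a                              ∎)))

    a<t : fromℕ a < t
    a<t = begin-strict
      fromℕ a              ≡⟨ ℚ.+-identityʳ (fromℕ a) ⟨
      fromℕ a + 0ℚ         <⟨ ℚ.+-monoʳ-< (fromℕ a) (1/1+-pos n) ⟩
      fromℕ a + 1/1+ n     ≡⟨ t≡ ⟩
      t                    ∎

  √ℚ-close : ∀ {m n p q e} → 0ℚ ≤ e → p ≤ q + e * e → √ℚ m p ≤ √ℚ n q + (1/1+ n + e)
  √ℚ-close {m} {n} {p} {q} {e} 0≤e p≤q+e² with √ℚ-lower m p
  ... | inj₁ s≡0  = ℚ.≤-trans (ℚ.≤-reflexive s≡0)
    (+-nonNeg (√ℚ-nonNeg n q) (+-nonNeg (1/1+-nonNeg n) 0≤e))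
  ... | inj₂ s²≤p = ℚ.≮⇒≥ λ c<s → ℚ.<-irrefl {x = p} refl (begin-strict
    p                                  ≤⟨ p≤q+e² ⟩
    q + e * e                          <⟨ ℚ.+-monoˡ-< (e * e) (√ℚ-upper n q) ⟩
    b * b + e * e                      ≡⟨ ℚ.+-identityʳ _ ⟨
    b * b + e * e + 0ℚ                 ≤⟨ ℚ.+-monoʳ-≤ (b * b + e * e) (+-nonNeg 0≤be 0≤be) ⟩
    b * b + e * e + (b * e + b * e)
      ≡⟨ solve 3 (λ r d e → (r :+ d) :* (r :+ d) :+ e :* e :+ ((r :+ d) :* e :+ (r :+ d) :* e)
                        := (r :+ (d :+ e)) :* (r :+ (d :+ e))) refl (√ℚ n q) (1/1+ n) e ⟩
    c * c                              <⟨ *-mono-< 0≤c c<s ⟩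
    √ℚ m p * √ℚ m p                    ≤⟨ s²≤p ⟩
    p                                  ∎)
    where
    b = √ℚ n q + 1/1+ n
    c = √ℚ n q + (1/1+ n + e)
    0≤be = *-nonNeg (+-nonNeg (√ℚ-nonNeg n q) (1/1+-nonNeg n)) 0≤e
    0≤c = +-nonNeg (√ℚ-nonNeg n q) (+-nonNeg (1/1+-nonNeg n) 0≤e)

------------------------------------------------------------------------

-- The reals are the rational Cauchy sequences up to _≈ʳ_ below.
record ℝ : Set where
  field
    seq    : ℕ → ℚ
    cauchy : ∀ e → 0ℚ ℚ.< e →
             ∃[ N ] ∀ m n → N ℕ.≤ m → N ℕ.≤ n → ℚ.∣ seq m ℚ.- seq n ∣ ℚ.≤ e

open ℝ public

module _ where
  open import Data.Rational.Base using (_+_; _*_; -_; _-_; _≤_; _<_; ∣_∣)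
  open ℚ.≤-Reasoning
  open +-*-Solver using (solve; _:=_; _:+_; _:*_; _:-_; :-_)

  +-cauchy : ∀ (x y : ℝ) e → 0ℚ < e →
             ∃[ N ] ∀ m n → N ℕ.≤ m → N ℕ.≤ n →
             ∣ (seq x m + seq y m) - (seq x n + seq y n) ∣ ≤ e
  +-cauchy x y e 0<e =
    let M , p = cauchy x (½ * e) (½-pos 0<e)
        N , q = cauchy y (½ * e) (½-pos 0<e)
    in M ℕ.⊔ N , λ m n M⊔N≤m M⊔N≤n → begin
      ∣ (seq x m + seq y m) - (seq x n + seq y n) ∣
        ≡⟨ cong ∣_∣ (solve 4 (λ a b c d → (a :+ b) :- (c :+ d) := (a :- c) :+ (b :- d)) refl
             (seq x m) (seq y m) (seq x n) (seq y n)) ⟩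
      ∣ (seq x m - seq x n) + (seq y m - seq y n) ∣
        ≤⟨ ℚ.∣p+q∣≤∣p∣+∣q∣ (seq x m - seq x n) (seq y m - seq y n) ⟩
      ∣ seq x m - seq x n ∣ + ∣ seq y m - seq y n ∣
        ≤⟨ ℚ.+-mono-≤ (p m n (ℕ.m⊔n≤o⇒m≤o M N M⊔N≤m) (ℕ.m⊔n≤o⇒m≤o M N M⊔N≤n))
                      (q m n (ℕ.m⊔n≤o⇒n≤o M N M⊔N≤m) (ℕ.m⊔n≤o⇒n≤o M N M⊔N≤n)) ⟩
      ½ * e + ½ * e
        ≡⟨ ½+½ e ⟩
      e ∎

  bounded : ∀ (x : ℝ) → ∃[ K ] 0ℚ < K × ∃[ N ] ∀ n → N ℕ.≤ n → ∣ seq x n ∣ ≤ K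
  bounded x =
    let N , p = cauchy x 1ℚ (ℚ.positive⁻¹ 1ℚ)
        xN = seq x N
    in ∣ xN ∣ + 1ℚ
     , ℚ.≤-<-trans (ℚ.0≤∣p∣ xN) (ℚ.≤-<-trans (ℚ.≤-reflexive (sym (ℚ.+-identityʳ ∣ xN ∣)))
         (ℚ.+-monoʳ-< ∣ xN ∣ (ℚ.positive⁻¹ 1ℚ)))
     , N , λ n N≤n → begin
       ∣ seq x n ∣
         ≡⟨ cong ∣_∣ (solve 2 (λ a b → a := b :+ (a :- b)) refl (seq x n) xN) ⟩
       ∣ xN + (seq x n - xN) ∣
         ≤⟨ ℚ.∣p+q∣≤∣p∣+∣q∣ xN (seq x n - xN) ⟩
       ∣ xN ∣ + ∣ seq x n - xN ∣
         ≤⟨ ℚ.+-monoʳ-≤ ∣ xN ∣ (p n N N≤n ℕ.≤-refl) ⟩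
       ∣ xN ∣ + 1ℚ ∎

  shrink : ∀ e K → 0ℚ < e → 0ℚ < K → ∃[ d ] 0ℚ < d × K * d ≡ e
  shrink e K 0<e 0<K = 1/K * e
    , *-pos (ℚ.positive⁻¹ 1/K {{ℚ.1/pos⇒pos K}}) 0<e
    , trans (sym (ℚ.*-assoc K 1/K e)) (trans (cong (_* e) (ℚ.*-inverseʳ K)) (ℚ.*-identityˡ e))
    where
    instance
      K-pos : ℚ.Positive K
      K-pos = ℚ.positive 0<K
      K-nonZero : ℚ.NonZero K
      K-nonZero = ℚ.pos⇒nonZero K
    1/K = ℚ.1/ K

  *-cauchy : ∀ (x y : ℝ) e → 0ℚ < e →
             ∃[ N ] ∀ m n → N ℕ.≤ m → N ℕ.≤ n →
             ∣ seq x m * seq y m - seq x n * seq y n ∣ ≤ e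
  *-cauchy x y e 0<e =
    let K , 0<K , A , bx = bounded x
        L , 0<L , B , by = bounded y
        d₁ , 0<d₁ , Kd₁ = shrink (½ * e) K (½-pos 0<e) 0<K
        d₂ , 0<d₂ , Ld₂ = shrink (½ * e) L (½-pos 0<e) 0<L
        C , p = cauchy y d₁ 0<d₁
        D , q = cauchy x d₂ 0<d₂
    in (A ℕ.⊔ B) ℕ.⊔ (C ℕ.⊔ D) , λ m n h k →
      let AB≤m = ℕ.m⊔n≤o⇒m≤o (A ℕ.⊔ B) (C ℕ.⊔ D) h
          CD≤m = ℕ.m⊔n≤o⇒n≤o (A ℕ.⊔ B) (C ℕ.⊔ D) h
          AB≤n = ℕ.m⊔n≤o⇒m≤o (A ℕ.⊔ B) (C ℕ.⊔ D) k
          CD≤n = ℕ.m⊔n≤o⇒n≤o (A ℕ.⊔ B) (C ℕ.⊔ D) k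
          Δx = seq x m - seq x n
          Δy = seq y m - seq y n
      in begin
      ∣ seq x m * seq y m - seq x n * seq y n ∣
        ≡⟨ cong ∣_∣ (solve 4 (λ a b c d → a :* b :- c :* d := a :* (b :- d) :+ d :* (a :- c)) refl
             (seq x m) (seq y m) (seq x n) (seq y n)) ⟩
      ∣ seq x m * Δy + seq y n * Δx ∣
        ≤⟨ ℚ.∣p+q∣≤∣p∣+∣q∣ (seq x m * Δy) (seq y n * Δx) ⟩
      ∣ seq x m * Δy ∣ + ∣ seq y n * Δx ∣
        ≡⟨ cong₂ _+_ (ℚ.∣p*q∣≡∣p∣*∣q∣ (seq x m) Δy) (ℚ.∣p*q∣≡∣p∣*∣q∣ (seq y n) Δx) ⟩
      ∣ seq x m ∣ * ∣ Δy ∣ + ∣ seq y n ∣ * ∣ Δx ∣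
        ≤⟨ ℚ.+-mono-≤
             (*-mono-≤ (ℚ.0≤∣p∣ (seq x m)) (ℚ.<⇒≤ 0<d₁) (bx m (ℕ.m⊔n≤o⇒m≤o A B AB≤m))
               (p m n (ℕ.m⊔n≤o⇒m≤o C D CD≤m) (ℕ.m⊔n≤o⇒m≤o C D CD≤n)))
             (*-mono-≤ (ℚ.0≤∣p∣ (seq y n)) (ℚ.<⇒≤ 0<d₂) (by n (ℕ.m⊔n≤o⇒n≤o A B AB≤n))
               (q m n (ℕ.m⊔n≤o⇒n≤o C D CD≤m) (ℕ.m⊔n≤o⇒n≤o C D CD≤n))) ⟩
      K * d₁ + L * d₂
        ≡⟨ cong₂ _+_ Kd₁ Ld₂ ⟩
      ½ * e + ½ * e
        ≡⟨ ½+½ e ⟩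
      e ∎

  neg-cauchy : ∀ (x : ℝ) e → 0ℚ < e →
               ∃[ N ] ∀ m n → N ℕ.≤ m → N ℕ.≤ n → ∣ - seq x m - - seq x n ∣ ≤ e
  neg-cauchy x e 0<e =
    let N , p = cauchy x e 0<e
    in N , λ m n N≤m N≤n → ℚ.≤-trans
      (ℚ.≤-reflexive (cong ∣_∣
        (solve 2 (λ a b → :- a :- :- b := b :- a) refl (seq x m) (seq x n))))
      (p n m N≤n N≤m)

  √-cauchy : ∀ (x : ℝ) e → 0ℚ < e →
             ∃[ N ] ∀ m n → N ℕ.≤ m → N ℕ.≤ n → ∣ √ℚ m (seq x m) - √ℚ n (seq x n) ∣ ≤ e
  √-cauchy x e 0<e =
    let d = ½ * e
        0<d = ½-pos 0<e
        N , p = cauchy x (d * d) (*-pos 0<d 0<d)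
        near : ∀ m n → N ℕ.⊔ ↧ₙ d ℕ.≤ m → N ℕ.⊔ ↧ₙ d ℕ.≤ n →
               √ℚ m (seq x m) ≤ √ℚ n (seq x n) + e
        near m n h k = ℚ.≤-trans
          (√ℚ-close {m} {n} {seq x m} {seq x n} {d} (ℚ.<⇒≤ 0<d) (∣p-q∣≤r⇒p≤q+r
            {seq x m} {seq x n} (p m n (ℕ.m⊔n≤o⇒m≤o N (↧ₙ d) h) (ℕ.m⊔n≤o⇒m≤o N (↧ₙ d) k))))
          (ℚ.+-monoʳ-≤ (√ℚ n (seq x n)) (ℚ.≤-trans
            (ℚ.+-monoˡ-≤ d (1/1+-small 0<d (ℕ.m⊔n≤o⇒n≤o N (↧ₙ d) k)))
            (ℚ.≤-reflexive (½+½ e))))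
    in N ℕ.⊔ ↧ₙ d , λ m n h k → close (near m n h k) (near n m k h)

infixl 6 _+ʳ_
infixl 7 _*ʳ_
infix  8 -ʳ_
infix  4 _≈ʳ_ _≤ʳ_

fromℚ : ℚ → ℝ
fromℚ q .seq n = q
fromℚ q .cauchy e 0<e = 0 , λ _ _ _ _ →
  ℚ.≤-trans (ℚ.≤-reflexive (cong ℚ.∣_∣ (ℚ.+-inverseʳ q))) (ℚ.<⇒≤ 0<e)

_+ʳ_ : ℝ → ℝ → ℝ
(x +ʳ y) .seq n  = seq x n ℚ.+ seq y n
(x +ʳ y) .cauchy = +-cauchy x y

_*ʳ_ : ℝ → ℝ → ℝ
(x *ʳ y) .seq n  = seq x n ℚ.* seq y n
(x *ʳ y) .cauchy = *-cauchy x y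

-ʳ_ : ℝ → ℝ
(-ʳ x) .seq n  = ℚ.- seq x n
(-ʳ x) .cauchy = neg-cauchy x

-- The square root of x for x ≥ 0; it is 0 for x ≤ 0.
√ : ℝ → ℝ
√ x .seq n  = √ℚ n (seq x n)
√ x .cauchy = √-cauchy x

_≈ʳ_ : Rel ℝ 0ℓ
x ≈ʳ y = ∀ e → 0ℚ ℚ.< e → ∃[ N ] ∀ n → N ℕ.≤ n → ℚ.∣ seq x n ℚ.- seq y n ∣ ℚ.≤ e

_≤ʳ_ : Rel ℝ 0ℓ
x ≤ʳ y = ∀ e → 0ℚ ℚ.< e → ∃[ N ] ∀ n → N ℕ.≤ n → seq x n ℚ.≤ seq y n ℚ.+ e

≈ʳ-respˡ-pointwise : ∀ x y z → (∀ n → seq x n ≡ seq y n) → x ≈ʳ z → y ≈ʳ z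
≈ʳ-respˡ-pointwise x y z eq x≈z e 0<e =
  let N , p = x≈z e 0<e
  in N , λ n N≤n → subst (λ a → ℚ.∣ a ℚ.- seq z n ∣ ℚ.≤ e) (eq n) (p n N≤n)

------------------------------------------------------------------------

infixl 6 _+ᶜ_
infixl 7 _*ᶜ_
infix  8 -ᶜ_
infix  4 _≈ᶜ_

record ℂ : Set where
  constructor _+i_
  field
    re im : ℝ

open ℂ public

0ᶜ 1ᶜ : ℂ
0ᶜ = fromℚ 0ℚ +i fromℚ 0ℚ
1ᶜ = fromℚ 1ℚ +i fromℚ 0ℚ

_+ᶜ_ _*ᶜ_ : ℂ → ℂ → ℂ
z +ᶜ w = (re z +ʳ re w) +i (im z +ʳ im w)
z *ᶜ w = (re z *ʳ re w +ʳ -ʳ (im z *ʳ im w)) +i (re z *ʳ im w +ʳ im z *ʳ re w)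

-ᶜ_ : ℂ → ℂ
-ᶜ z = (-ʳ re z) +i (-ʳ im z)

∣_∣ᶜ : ℂ → ℝ
∣ z ∣ᶜ = √ (re z *ʳ re z +ʳ im z *ʳ im z)

_≈ᶜ_ : Rel ℂ 0ℓ
z ≈ᶜ w = re z ≈ʳ re w × im z ≈ʳ im w

------------------------------------------------------------------------

Matrix : ℕ → Set
Matrix n = Fin n → Fin n → ℂ

∑ : Vector ℂ n → ℂ
∑ = Vector.foldr _+ᶜ_ 0ᶜ

_·ᵥ_ : Matrix n → Vector ℂ n → Vector ℂ n
(M ·ᵥ v) s = ∑ (λ t → M s t *ᶜ v t)

IsEigenvalue : Matrix n → ℂ → Set
IsEigenvalue {n} M μ = Σ[ v ∈ Vector ℂ n ]
  ¬ (∀ s → v s ≈ᶜ 0ᶜ) × (∀ s → (M ·ᵥ v) s ≈ᶜ μ *ᶜ v s)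

-- r is the maximum of ∣ μ ∣ over the eigenvalues μ of M. This is a relation because
-- extracting the maximum as a function of M would need root finding; it determines r.
IsSpectralRadius : Matrix n → ℝ → Set
IsSpectralRadius M r =
  (∃[ μ ] IsEigenvalue M μ × ∣ μ ∣ᶜ ≈ʳ r) × (∀ μ → IsEigenvalue M μ → ∣ μ ∣ᶜ ≤ʳ r)

------------------------------------------------------------------------

record Graph (n : ℕ) : Set₁ where
  infix 4 _~_ _~?_
  field
    _~_     : Rel (Fin n) 0ℓ
    _~?_    : Decidable _~_
    ~-sym   : Symmetric _~_
    ~-irrefl : Irreflexive _≡_ _~_

  Walk : Rel (Fin n) 0ℓ
  Walk = Star _~_

  -- The graph with no vertices is not connected.
  Connected : Set
  Connected = ℕ.NonZero n × (∀ s t → Walk s t)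

  degree : Fin n → ℕ
  degree s = length (filter (s ~?_) (allFin n))

  maxDegree : ℕ
  maxDegree = max 0 (map degree (allFin n))

  Regular : ℕ → Set
  Regular k = ∀ s → degree s ≡ k

  -- All vertices of a walk but its last.
  visited : ∀ {s t} → Walk s t → List (Fin n)
  visited ε             = []
  visited (_◅_ {s} _ w) = s ∷ visited w

  -- A closed walk on at least three vertices, repeating none but the base on return.
  record DirectedCycle : Set where
    field
      base     : Fin n
      walk     : Walk base base
      distinct : Unique (visited walk)
      3≤length : 3 ℕ.≤ length (visited walk)

------------------------------------------------------------------------

-- The gain depends on the oriented edge (s, t) only, not on the proof of s ~ t.
record GainGraph (G : Graph n) : Set where
  open Graph G
  field
    φ    : ∀ s t → .(s ~ t) → ℂ
    unit : ∀ s t (e : s ~ t) → ∣ φ s t e ∣ᶜ ≈ʳ fromℚ 1ℚ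
    inv  : ∀ s t (e : s ~ t) → φ t s (~-sym e) *ᶜ φ s t e ≈ᶜ 1ᶜ

  A : Matrix n
  A s t with s ~? t
  ... | yes e = φ s t e
  ... | no  _ = 0ᶜ

  gain : ∀ {s t} → Walk s t → ℂ
  gain ε                 = 1ᶜ
  gain (_◅_ {s} {t} e w) = φ s t e *ᶜ gain w

  Balanced : Set
  Balanced = ∀ (C : DirectedCycle) → gain (DirectedCycle.walk C) ≈ᶜ 1ᶜ

module _ where
  open import Data.Rational.Base using (_+_; _*_; -_)
  open +-*-Solver using (solve; _:=_; _:+_; _:*_; :-_)

  ∣-z∣ᶜ : ∀ z n → seq ∣ z ∣ᶜ n ≡ seq ∣ -ᶜ z ∣ᶜ n
  ∣-z∣ᶜ z n = cong (√ℚ n)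
    (solve 2 (λ a b → a :* a :+ b :* b := :- a :* :- a :+ :- b :* :- b) refl
      (seq (re z) n) (seq (im z) n))

  re-neg*neg : ∀ z w n → seq (re (z *ᶜ w)) n ≡ seq (re (-ᶜ z *ᶜ -ᶜ w)) n
  re-neg*neg z w n =
    solve 4 (λ a b c d → a :* c :+ :- (b :* d) := :- a :* :- c :+ :- (:- b :* :- d)) refl
      (seq (re z) n) (seq (im z) n) (seq (re w) n) (seq (im w) n)

  im-neg*neg : ∀ z w n → seq (im (z *ᶜ w)) n ≡ seq (im (-ᶜ z *ᶜ -ᶜ w)) n
  im-neg*neg z w n =
    solve 4 (λ a b c d → a :* d :+ b :* c := :- a :* :- d :+ :- b :* :- c) refl
      (seq (re z) n) (seq (im z) n) (seq (re w) n) (seq (im w) n)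

-ᵍ_ : {G : Graph n} → GainGraph G → GainGraph G
-ᵍ_ {G = G} Φ = record
  { φ    = λ s t e → -ᶜ φ s t e
  ; unit = λ s t e → ≈ʳ-respˡ-pointwise ∣ φ s t e ∣ᶜ ∣ -ᶜ φ s t e ∣ᶜ (fromℚ 1ℚ)
             (∣-z∣ᶜ (φ s t e)) (unit s t e)
  ; inv  = λ s t e →
      let z = φ t s (~-sym e)
          w = φ s t e
      in ≈ʳ-respˡ-pointwise (re (z *ᶜ w)) (re (-ᶜ z *ᶜ -ᶜ w)) (fromℚ 1ℚ)
           (re-neg*neg z w) (proj₁ (inv s t e))
       , ≈ʳ-respˡ-pointwise (im (z *ᶜ w)) (im (-ᶜ z *ᶜ -ᶜ w)) (fromℚ 0ℚ)
           (im-neg*neg z w) (proj₂ (inv s t e))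
  }
  where
  open GainGraph Φ
  open Graph G

{-# OPTIONS --safe #-}
module Submission where

-- Let A v = μ v and let ∥ v_s ∥ be maximal. The quantities ∥ c A_st v_t − μ v_s ∥² +
-- c² (∥ v_s ∥² − ∥ v_t ∥²), summed over the neighbours t of s, give
-- (d (c² + ∥ μ ∥²) − 2 c ∥ μ ∥²) ∥ v_s ∥² with d = deg s, a nonnegative number. With c = Δ this
-- bounds ∥ μ ∥ by Δ, and if ∥ μ ∥ = Δ, then d = Δ and Δ φ_st v_t = μ v_s for every neighbour t,
-- which is again a maximal vertex; by connectedness this holds on all of G. Hence μ² = Δ² and
-- φ_st v_t = ± v_s on every edge, so that Φ or −Φ is balanced.
-- Conversely, if Φ is balanced, then by loop erasure every closed walk has gain 1, and
-- v_s = gain of any walk from s to a base vertex is an eigenvector for Δ.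
--
-- Inequalities between reals are ¬¬-stable, so maximal vertices may be chosen under a double
-- negation. Only the alternative between Φ and −Φ has to be decided; the sign of μ does it.

open import Defs
open import Algebra.Bundles using (CommutativeRing)
import Algebra.Properties.Semiring.Sum as Sum
import Algebra.Solver.CommutativeMonoid as CommutativeMonoidSolver
import Algebra.Solver.Ring as RingSolver
open import Algebra.Solver.Ring.AlmostCommutativeRing as ACR using (fromCommutativeRing)
open import Data.Empty using (⊥-elim)
open import Data.Fin.Base using (Fin; zero; suc)
import Data.Fin.Properties as Fin
open import Data.List.Base using (List; []; _∷_; length; filter; tabulate; map; allFin)
open import Data.List.Extrema.Nat using (xs≤max)
import Data.List.Membership.DecPropositional as DecMembership
open import Data.List.Membership.Propositional using (_∈_)
open import Data.List.Membership.Propositional.Properties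
  using (∈-map⁺; ∈-filter⁺; ∈-allFin; ∈-length)
open import Data.List.Relation.Unary.All as All using (All; []; _∷_)
open import Data.List.Relation.Unary.All.Properties using (¬Any⇒All¬)
open import Data.List.Relation.Unary.AllPairs using ([]; _∷_)
open import Data.List.Relation.Unary.Any using (here; there)
open import Data.List.Relation.Unary.Unique.Propositional using (Unique)
open import Data.Maybe.Base using (Maybe; just; nothing)
open import Data.Nat.Base as ℕ using (ℕ; zero; suc)
import Data.Nat.Properties as ℕ
open import Data.Product.Base using (Σ-syntax; ∃-syntax; _×_; _,_; proj₁; proj₂)
open import Data.Rational.Base as ℚ using (ℚ; 0ℚ; 1ℚ; ½; ↧ₙ_)
import Data.Rational.Properties as ℚ
import Data.Rational.Solver as ℚ
open import Data.Sum.Base using (_⊎_; inj₁; inj₂)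
open import Data.Vec.Functional as Vector using (Vector)
open import Function.Bundles using (_⇔_; mk⇔)
open import Level using (0ℓ)
open import Relation.Binary.Bundles using (Poset; Setoid)
open import Relation.Binary.Construct.Closure.ReflexiveTransitive using (ε; _◅_; _◅◅_)
open import Relation.Binary.PropositionalEquality as ≡ using (_≡_; _≢_)
open import Relation.Nullary using (¬_; Dec; yes; no)
open import Relation.Nullary.Decidable.Core using (¬¬-excluded-middle; decidable-stable)
open import Relation.Unary using (Pred; Decidable)

-- Order and equality of the reals

infix 4 _≃_ _⊑_

-- ≈ʳ and ≤ʳ unfold to quantified statements about sequences, from which Agda cannot
-- recover the two reals; the records keep them visible.
record _≃_ (x y : ℝ) : Set where
  constructor mk
  field raw : x ≈ʳ y

record _⊑_ (x y : ℝ) : Set where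
  constructor mk
  field raw : x ≤ʳ y

infixl 6 _⊕_
infixl 7 _⊗_
infix  8 ⊖_

-- Records of sequences have η-equality and the operations of Defs unfold to them, which
-- makes unification compare Cauchy moduli; opaque copies are compared by their arguments.
opaque
  ι : ℚ → ℝ
  ι = fromℚ

  _⊕_ _⊗_ : ℝ → ℝ → ℝ
  _⊕_ = _+ʳ_
  _⊗_ = _*ʳ_

  ⊖_ : ℝ → ℝ
  ⊖_ = -ʳ_

0ʳ 1ʳ : ℝ
0ʳ = ι 0ℚ
1ʳ = ι 1ℚ

module _ where
  open import Data.Rational.Base using (_+_; _*_; -_; _-_; _≤_; _<_; ∣_∣)
  open ℚ.≤-Reasoning
  open ℚ.+-*-Solver

  p≤p+e : ∀ {p e} → 0ℚ < e → p ≤ p + e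
  p≤p+e {p} {e} 0<e = begin
    p         ≡⟨ ℚ.+-identityʳ p ⟨
    p + 0ℚ    ≤⟨ ℚ.+-monoʳ-≤ p (ℚ.<⇒≤ 0<e) ⟩
    p + e     ∎

  ∣p-q∣≤r⇒q≤p+r : ∀ {p q r} → ∣ p - q ∣ ≤ r → q ≤ p + r
  ∣p-q∣≤r⇒q≤p+r {p} {q} {r} h = ∣p-q∣≤r⇒p≤q+r {q} {p}
    (≡.subst (_≤ r) (≡.trans (≡.sym (ℚ.∣-p∣≡∣p∣ (p - q)))
      (≡.cong ∣_∣ (solve 2 (λ p q → :- (p :- q) := q :- p) ≡.refl p q))) h)

  ⊑-refl : ∀ {x} → x ⊑ x
  ⊑-refl = mk λ e 0<e → 0 , λ n _ → p≤p+e 0<e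

  ⊑-pointwise : ∀ {x y} → (∀ n → seq x n ≤ seq y n) → x ⊑ y
  ⊑-pointwise h = mk λ e 0<e → 0 , λ n _ → ℚ.≤-trans (h n) (p≤p+e 0<e)

  ⊑-trans : ∀ {x y z} → x ⊑ y → y ⊑ z → x ⊑ z
  ⊑-trans {x} {y} {z} (mk f) (mk g) = mk λ e 0<e →
    let M , p = f (½ * e) (½-pos 0<e)
        N , q = g (½ * e) (½-pos 0<e)
    in M ℕ.⊔ N , λ n h → begin
      seq x n                       ≤⟨ p n (ℕ.m⊔n≤o⇒m≤o M N h) ⟩
      seq y n + ½ * e               ≤⟨ ℚ.+-monoˡ-≤ (½ * e) (q n (ℕ.m⊔n≤o⇒n≤o M N h)) ⟩
      seq z n + ½ * e + ½ * e       ≡⟨ solve 2 (λ a e → a :+ con ½ :* e :+ con ½ :* e := a :+ e)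
                                         ≡.refl (seq z n) e ⟩
      seq z n + e                   ∎

  ⊑-antisym : ∀ {x y} → x ⊑ y → y ⊑ x → x ≃ y
  ⊑-antisym (mk f) (mk g) = mk λ e 0<e →
    let M , p = f e 0<e
        N , q = g e 0<e
    in M ℕ.⊔ N , λ n h → close (p n (ℕ.m⊔n≤o⇒m≤o M N h)) (q n (ℕ.m⊔n≤o⇒n≤o M N h))

  ≃⇒⊑ : ∀ {x y} → x ≃ y → x ⊑ y
  ≃⇒⊑ {x} {y} (mk f) = mk λ e 0<e →
    let N , p = f e 0<e in N , λ n h → ∣p-q∣≤r⇒p≤q+r {seq x n} {seq y n} (p n h)

  ≃⇒⊒ : ∀ {x y} → x ≃ y → y ⊑ x
  ≃⇒⊒ {x} {y} (mk f) = mk λ e 0<e →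
    let N , p = f e 0<e in N , λ n h → ∣p-q∣≤r⇒q≤p+r {seq x n} {seq y n} (p n h)

  ≃-refl : ∀ {x} → x ≃ x
  ≃-refl = ⊑-antisym ⊑-refl ⊑-refl

  ≃-sym : ∀ {x y} → x ≃ y → y ≃ x
  ≃-sym h = ⊑-antisym (≃⇒⊒ h) (≃⇒⊑ h)

  ≃-trans : ∀ {x y z} → x ≃ y → y ≃ z → x ≃ z
  ≃-trans h k = ⊑-antisym (⊑-trans (≃⇒⊑ h) (≃⇒⊑ k)) (⊑-trans (≃⇒⊒ k) (≃⇒⊒ h))

  pointwise : ∀ {x y} → (∀ n → seq x n ≡ seq y n) → x ≃ y
  pointwise h = ⊑-antisym (⊑-pointwise λ n → ℚ.≤-reflexive (h n))
    (⊑-pointwise λ n → ℚ.≤-reflexive (≡.sym (h n)))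

-- The reals as a commutative ring

module _ where
  open import Data.Rational.Base using (_+_; _*_; -_; _-_; _≤_; _<_; ∣_∣)
  open ℚ.≤-Reasoning
  open ℚ.+-*-Solver

  opaque
    unfolding ι

    ⊕-mono-⊑ : ∀ {x y u v} → x ⊑ y → u ⊑ v → x ⊕ u ⊑ y ⊕ v
    ⊕-mono-⊑ {x} {y} {u} {v} (mk f) (mk g) = mk λ e 0<e →
      let M , p = f (½ * e) (½-pos 0<e)
          N , q = g (½ * e) (½-pos 0<e)
      in M ℕ.⊔ N , λ n h → begin
        seq x n + seq u n
          ≤⟨ ℚ.+-mono-≤ (p n (ℕ.m⊔n≤o⇒m≤o M N h)) (q n (ℕ.m⊔n≤o⇒n≤o M N h)) ⟩
        (seq y n + ½ * e) + (seq v n + ½ * e)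
          ≡⟨ solve 3 (λ a b e → (a :+ con ½ :* e) :+ (b :+ con ½ :* e) := a :+ b :+ e) ≡.refl
               (seq y n) (seq v n) e ⟩
        seq y n + seq v n + e ∎

    ⊖-anti-⊑ : ∀ {x y} → x ⊑ y → ⊖ y ⊑ ⊖ x
    ⊖-anti-⊑ {x} {y} (mk f) = mk λ e 0<e →
      let N , p = f e 0<e in N , λ n h → begin
        - seq y n                          ≡⟨ solve 2 (λ b e → :- b := :- (b :+ e) :+ e) ≡.refl
                                                (seq y n) e ⟩
        - (seq y n + e) + e                ≤⟨ ℚ.+-monoˡ-≤ e (ℚ.neg-antimono-≤ (p n h)) ⟩
        - seq x n + e                      ∎

    -- The factor `x` is eventually bounded by some `K`, so the tolerance `e / K` for `y` and `z`
    -- yields the tolerance `e` for the products.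
    ⊗-congˡ : ∀ {x y z} → y ≃ z → x ⊗ y ≃ x ⊗ z
    ⊗-congˡ {x} {y} {z} (mk f) = mk λ e 0<e →
      let K , 0<K , M , b = bounded x
          d , 0<d , Kd≡e = shrink e K 0<e 0<K
          N , p = f d 0<d
      in M ℕ.⊔ N , λ n h → begin
        ∣ seq x n * seq y n - seq x n * seq z n ∣
          ≡⟨ ≡.cong ∣_∣ (solve 3 (λ a b c → a :* b :- a :* c := a :* (b :- c)) ≡.refl
               (seq x n) (seq y n) (seq z n)) ⟩
        ∣ seq x n * (seq y n - seq z n) ∣
          ≡⟨ ℚ.∣p*q∣≡∣p∣*∣q∣ (seq x n) (seq y n - seq z n) ⟩
        ∣ seq x n ∣ * ∣ seq y n - seq z n ∣
          ≤⟨ *-mono-≤ (ℚ.0≤∣p∣ (seq x n)) (ℚ.<⇒≤ 0<d) (b n (ℕ.m⊔n≤o⇒m≤o M N h))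
               (p n (ℕ.m⊔n≤o⇒n≤o M N h)) ⟩
        K * d
          ≡⟨ Kd≡e ⟩
        e ∎

    ⊕-assoc : ∀ x y z → (x ⊕ y) ⊕ z ≃ x ⊕ (y ⊕ z)
    ⊕-assoc x y z = pointwise λ n → ℚ.+-assoc (seq x n) (seq y n) (seq z n)

    ⊕-comm : ∀ x y → x ⊕ y ≃ y ⊕ x
    ⊕-comm x y = pointwise λ n → ℚ.+-comm (seq x n) (seq y n)

    ⊕-identityˡ : ∀ x → 0ʳ ⊕ x ≃ x
    ⊕-identityˡ x = pointwise λ n → ℚ.+-identityˡ (seq x n)

    ⊖-inverseˡ : ∀ x → ⊖ x ⊕ x ≃ 0ʳ
    ⊖-inverseˡ x = pointwise λ n → ℚ.+-inverseˡ (seq x n)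

    ⊗-assoc : ∀ x y z → (x ⊗ y) ⊗ z ≃ x ⊗ (y ⊗ z)
    ⊗-assoc x y z = pointwise λ n → ℚ.*-assoc (seq x n) (seq y n) (seq z n)

    ⊗-comm : ∀ x y → x ⊗ y ≃ y ⊗ x
    ⊗-comm x y = pointwise λ n → ℚ.*-comm (seq x n) (seq y n)

    ⊗-identityˡ : ∀ x → 1ʳ ⊗ x ≃ x
    ⊗-identityˡ x = pointwise λ n → ℚ.*-identityˡ (seq x n)

    ⊗-distribˡ-⊕ : ∀ x y z → x ⊗ (y ⊕ z) ≃ x ⊗ y ⊕ x ⊗ z
    ⊗-distribˡ-⊕ x y z = pointwise λ n → ℚ.*-distribˡ-+ (seq x n) (seq y n) (seq z n)

    ι-⊕ : ∀ p q → ι (p + q) ≃ ι p ⊕ ι q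
    ι-⊕ p q = pointwise λ _ → ≡.refl

    ι-⊗ : ∀ p q → ι (p * q) ≃ ι p ⊗ ι q
    ι-⊗ p q = pointwise λ _ → ≡.refl

    ι-⊖ : ∀ p → ι (- p) ≃ ⊖ ι p
    ι-⊖ p = pointwise λ _ → ≡.refl

⊕-cong : ∀ {x y u v} → x ≃ y → u ≃ v → x ⊕ u ≃ y ⊕ v
⊕-cong h k = ⊑-antisym (⊕-mono-⊑ (≃⇒⊑ h) (≃⇒⊑ k)) (⊕-mono-⊑ (≃⇒⊒ h) (≃⇒⊒ k))

⊖-cong : ∀ {x y} → x ≃ y → ⊖ x ≃ ⊖ y
⊖-cong h = ⊑-antisym (⊖-anti-⊑ (≃⇒⊒ h)) (⊖-anti-⊑ (≃⇒⊑ h))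

⊗-cong : ∀ {x y u v} → x ≃ y → u ≃ v → x ⊗ u ≃ y ⊗ v
⊗-cong {x} {y} {u} {v} h k = ≃-trans (⊗-congˡ k)
  (≃-trans (⊗-comm x v) (≃-trans (⊗-congˡ h) (⊗-comm v y)))

ℝ-setoid : Setoid 0ℓ 0ℓ
ℝ-setoid = record
  { Carrier = ℝ ; _≈_ = _≃_
  ; isEquivalence = record { refl = ≃-refl ; sym = ≃-sym ; trans = ≃-trans } }

ℝ-commutativeRing : CommutativeRing 0ℓ 0ℓ
ℝ-commutativeRing = record
  { Carrier = ℝ ; _≈_ = _≃_ ; _+_ = _⊕_ ; _*_ = _⊗_ ; -_ = ⊖_ ; 0# = 0ʳ ; 1# = 1ʳ
  ; isCommutativeRing = record
    { isRing = record
      { +-isAbelianGroup = record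
        { isGroup = record
          { isMonoid = record
            { isSemigroup = record
              { isMagma = record { isEquivalence = Setoid.isEquivalence ℝ-setoid ; ∙-cong = ⊕-cong }
              ; assoc = ⊕-assoc }
            ; identity = comm∧idˡ⇒id ⊕-comm ⊕-identityˡ }
          ; inverse = comm∧invˡ⇒inv ⊕-comm ⊖-inverseˡ
          ; ⁻¹-cong = ⊖-cong }
        ; comm = ⊕-comm }
      ; *-cong = ⊗-cong
      ; *-assoc = ⊗-assoc
      ; *-identity = comm∧idˡ⇒id ⊗-comm ⊗-identityˡ
      ; distrib = comm∧distrˡ⇒distr ⊕-cong ⊗-comm ⊗-distribˡ-⊕ }
    ; *-comm = ⊗-comm } }
  where open import Algebra.Consequences.Setoid ℝ-setoid

-- Equality of reals is undecidable, so the ring solver takes its coefficients from ℚ, embedded as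
-- constant sequences.
ι-morphism : CommutativeRing.rawRing ℚ.+-*-commutativeRing
               ACR.-Raw-AlmostCommutative⟶ fromCommutativeRing ℝ-commutativeRing
ι-morphism = record
  { ⟦_⟧ = ι
  ; +-homo = ι-⊕
  ; *-homo = ι-⊗
  ; -‿homo = ι-⊖
  ; 0-homo = ≃-refl
  ; 1-homo = ≃-refl
  }

ι-≟ : (p q : ℚ) → Maybe (ι p ≃ ι q)
ι-≟ p q with p ℚ.≟ q
... | yes ≡.refl = just ≃-refl
... | no  _      = nothing

module ℝ-Solver = RingSolver (CommutativeRing.rawRing ℚ.+-*-commutativeRing)
  (fromCommutativeRing ℝ-commutativeRing) ι-morphism ι-≟

⊑-poset : Poset 0ℓ 0ℓ 0ℓ
⊑-poset = record
  { Carrier = ℝ ; _≈_ = _≃_ ; _≤_ = _⊑_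
  ; isPartialOrder = record
    { isPreorder = record
      { isEquivalence = Setoid.isEquivalence ℝ-setoid
      ; reflexive = ≃⇒⊑
      ; trans = ⊑-trans }
    ; antisym = ⊑-antisym } }

module ⊑-Reasoning where
  open import Relation.Binary.Reasoning.PartialOrder ⊑-poset public

open ℝ-Solver using (solve; _:=_; _:+_; _:*_; _:-_; :-_; con)

-- Positivity and double negation

module _ where
  open import Data.Rational.Base using (_+_; _*_; -_; _-_; _≤_; _<_; ∣_∣)
  open ℚ.≤-Reasoning
  open ℚ.+-*-Solver using () renaming
    ( solve to solveℚ; con to conℚ; _:=_ to _:=ℚ_; _:+_ to _:+ℚ_; _:*_ to _:*ℚ_
    ; _:-_ to _:-ℚ_; :-_ to :-ℚ_ )

  Eventually : (ℕ → Set) → Set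
  Eventually P = ∃[ N ] ∀ n → N ℕ.≤ n → P n

  -- A constructive substitute for comparing `x` with 0. From some index `N` on, the sequence moves
  -- by at most `e / 4`, so comparing the single rational `seq x N` with `e / 2` settles the matter;
  -- the positive bound found is `e / 4`.
  small⊎positive : ∀ x e → 0ℚ < e →
    Eventually (λ n → seq x n ≤ e) ⊎ (∃[ q ] 0ℚ < q × Eventually (λ n → q ≤ seq x n))
  small⊎positive x e 0<e with cauchy x (½ * (½ * e)) (½-pos (½-pos 0<e))
  ... | N , p with seq x N ℚ.≤? ½ * e
  ...   | yes xN≤ = inj₁ (N , λ n N≤n → begin
            seq x n                      ≤⟨ ∣p-q∣≤r⇒p≤q+r {seq x n} {seq x N} (p n N N≤n ℕ.≤-refl) ⟩
            seq x N + ½ * (½ * e)        ≤⟨ ℚ.+-monoˡ-≤ (½ * (½ * e)) xN≤ ⟩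
            ½ * e + ½ * (½ * e)          ≤⟨ p≤p+e (½-pos (½-pos 0<e)) ⟩
            ½ * e + ½ * (½ * e) + ½ * (½ * e)
              ≡⟨ solveℚ 1 (λ e → conℚ ½ :*ℚ e :+ℚ conℚ ½ :*ℚ (conℚ ½ :*ℚ e)
                                   :+ℚ conℚ ½ :*ℚ (conℚ ½ :*ℚ e) :=ℚ e) ≡.refl e ⟩
            e                            ∎)
  ...   | no  xN≰ = inj₂ (½ * (½ * e) , ½-pos (½-pos 0<e) , N , λ n N≤n →
            begin
            ½ * (½ * e)                  ≡⟨ solveℚ 1 (λ e → conℚ ½ :*ℚ (conℚ ½ :*ℚ e) :=ℚ
                                              conℚ ½ :*ℚ e :-ℚ conℚ ½ :*ℚ (conℚ ½ :*ℚ e)) ≡.refl e ⟩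
            ½ * e - ½ * (½ * e)          ≤⟨ ℚ.+-monoˡ-≤ (- (½ * (½ * e))) (ℚ.<⇒≤ (ℚ.≰⇒> xN≰)) ⟩
            seq x N - ½ * (½ * e)        ≤⟨ p≤q+r⇒p-q≤r {seq x N} {½ * (½ * e)} (≡.subst (seq x N ≤_)
                                              (ℚ.+-comm (seq x n) (½ * (½ * e)))
                                              (∣p-q∣≤r⇒p≤q+r {seq x N} {seq x n}
                                                (p N n ℕ.≤-refl N≤n))) ⟩
            seq x n                      ∎)

  opaque
    unfolding ι

    ι-mono-⊑ : ∀ {p q} → p ≤ q → ι p ⊑ ι q
    ι-mono-⊑ p≤q = ⊑-pointwise λ _ → p≤q

    ι-cancel-⊑ : ∀ {p q} → ι p ⊑ ι q → p ≤ q
    ι-cancel-⊑ {p} {q} (mk f) = ℚ.≮⇒≥ λ q<p →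
      let 0<d = ≡.subst (_< p - q) (ℚ.+-inverseʳ q) (ℚ.+-monoˡ-< (- q) q<p)
          -- A tolerance of half the gap is too small to bridge it.
          N , h = f (½ * (p - q)) (½-pos 0<d)
      in ℚ.<-irrefl ≡.refl (begin-strict
        p                          ≤⟨ h N ℕ.≤-refl ⟩
        q + ½ * (p - q)            ≡⟨ ℚ.+-identityʳ _ ⟨
        q + ½ * (p - q) + 0ℚ       <⟨ ℚ.+-monoʳ-< (q + ½ * (p - q)) (½-pos 0<d) ⟩
        q + ½ * (p - q) + ½ * (p - q) ≡⟨ ℚ.+-assoc q _ _ ⟩
        q + (½ * (p - q) + ½ * (p - q)) ≡⟨ ≡.cong (q +_) (½+½ (p - q)) ⟩
        q + (p - q)                ≡⟨ ℚ.+-comm q (p - q) ⟩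
        p - q + q                  ≡⟨ ℚ.+-assoc p (- q) q ⟩
        p + (- q + q)              ≡⟨ ≡.cong (p +_) (ℚ.+-inverseˡ q) ⟩
        p + 0ℚ                     ≡⟨ ℚ.+-identityʳ p ⟩
        p                          ∎)

    eventually-⊒ : ∀ {x q} → Eventually (λ n → q ≤ seq x n) → ι q ⊑ x
    eventually-⊒ {x} (N , h) = mk λ e 0<e → N , λ n N≤n → ℚ.≤-trans (h n N≤n) (p≤p+e 0<e)

    eventually-⊑ : ∀ {x q} → Eventually (λ n → seq x n ≤ q) → x ⊑ ι q
    eventually-⊑ {x} (N , h) = mk λ e 0<e → N , λ n N≤n → ℚ.≤-trans (h n N≤n) (p≤p+e 0<e)

    arbitrarily-small⇒⊑0 : ∀ {x} → (∀ e → 0ℚ < e → Eventually (λ n → seq x n ≤ e)) → x ⊑ 0ʳ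
    arbitrarily-small⇒⊑0 {x} h = mk λ e 0<e → let N , p = h e 0<e in
      N , λ n N≤n → ℚ.≤-trans (p n N≤n) (ℚ.≤-reflexive (≡.sym (ℚ.+-identityˡ e)))

    0⊑x⊗x : ∀ x → 0ʳ ⊑ x ⊗ x
    0⊑x⊗x x = ⊑-pointwise λ n → nonNeg (seq x n)
      where
      nonNeg : ∀ p → 0ℚ ≤ p * p
      nonNeg p = ≡.subst (0ℚ ≤_) (∣p∣*∣p∣≡p*p (ℚ.∣p∣≡p∨∣p∣≡-p p)) (*-nonNeg (ℚ.0≤∣p∣ p) (ℚ.0≤∣p∣ p))
        where
        ∣p∣*∣p∣≡p*p : ∣ p ∣ ≡ p ⊎ ∣ p ∣ ≡ - p → ∣ p ∣ * ∣ p ∣ ≡ p * p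
        ∣p∣*∣p∣≡p*p (inj₁ eq) = ≡.cong₂ _*_ eq eq
        ∣p∣*∣p∣≡p*p (inj₂ eq) = ≡.trans (≡.cong₂ _*_ eq eq)
          (solveℚ 1 (λ p → :-ℚ p :*ℚ :-ℚ p :=ℚ p :*ℚ p) ≡.refl p)

    bounded-below-⊗ : ∀ {x y p q} → 0ℚ < p → 0ℚ < q → Eventually (λ n → p ≤ seq x n) →
                      Eventually (λ n → q ≤ seq y n) → ι (p * q) ⊑ x ⊗ y
    bounded-below-⊗ {x} {y} 0<p 0<q (M , f) (N , g) = eventually-⊒ (M ℕ.⊔ N , λ n h →
      *-mono-≤ (ℚ.<⇒≤ 0<p) (ℚ.≤-trans (ℚ.<⇒≤ 0<q) (g n (ℕ.m⊔n≤o⇒n≤o M N h)))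
        (f n (ℕ.m⊔n≤o⇒m≤o M N h)) (g n (ℕ.m⊔n≤o⇒n≤o M N h)))

  -- Without a positive lower bound, `small⊎positive` can only answer that `x` is small, and it does
  -- so for every `e`.
  ¬⊑0⇒¬¬positive : ∀ {x} → ¬ x ⊑ 0ʳ → ¬ ¬ (∃[ q ] 0ℚ < q × Eventually (λ n → q ≤ seq x n))
  ¬⊑0⇒¬¬positive {x} x≰0 k = x≰0 (arbitrarily-small⇒⊑0 λ e 0<e → go e (small⊎positive x e 0<e))
    where
    go : ∀ e → Eventually (λ n → seq x n ≤ e) ⊎ _ → Eventually (λ n → seq x n ≤ e)
    go e (inj₁ h) = h
    go e (inj₂ h) = ⊥-elim (k h)

  positive⇒¬⊑0 : ∀ {x q} → 0ℚ < q → ι q ⊑ x → ¬ x ⊑ 0ʳ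
  positive⇒¬⊑0 0<q q⊑x x⊑0 = ℚ.<-irrefl ≡.refl (ℚ.<-≤-trans 0<q (ι-cancel-⊑ (⊑-trans q⊑x x⊑0)))

  -- `¬ x ⊑ 0ʳ` serves as strict positivity. The conclusion is a negation, so the doubly negated
  -- rational lower bounds may be used.
  ⊗-pos : ∀ {x y} → ¬ x ⊑ 0ʳ → ¬ y ⊑ 0ʳ → ¬ x ⊗ y ⊑ 0ʳ
  ⊗-pos x≰0 y≰0 xy⊑0 = ¬⊑0⇒¬¬positive x≰0 λ { (p , 0<p , f) →
    ¬⊑0⇒¬¬positive y≰0 λ { (q , 0<q , g) →
      positive⇒¬⊑0 (*-pos 0<p 0<q) (bounded-below-⊗ 0<p 0<q f g) xy⊑0 } }

  -- A positive lower bound refutes `x ⊑ 0ʳ`, so for every `e` only the other answer of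
  -- `small⊎positive` is compatible with the double negation.
  ⊑0-stable : ∀ {x} → ¬ ¬ x ⊑ 0ʳ → x ⊑ 0ʳ
  ⊑0-stable {x} ¬¬x⊑0 = arbitrarily-small⇒⊑0 λ e 0<e → go e (small⊎positive x e 0<e)
    where
    go : ∀ e → Eventually (λ n → seq x n ≤ e) ⊎ _ → Eventually (λ n → seq x n ≤ e)
    go e (inj₁ h) = h
    go e (inj₂ (q , 0<q , h)) = ⊥-elim (¬¬x⊑0 (positive⇒¬⊑0 0<q (eventually-⊒ h)))

infixl 6 _⊝_

_⊝_ : ℝ → ℝ → ℝ
x ⊝ y = x ⊕ ⊖ y

⊑⇒⊝⊑0 : ∀ {x y} → x ⊑ y → x ⊝ y ⊑ 0ʳ
⊑⇒⊝⊑0 {x} {y} h = ⊑-trans (⊕-mono-⊑ h (⊑-refl {⊖ y}))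
  (≃⇒⊑ (solve 1 (λ y → y :- y := con 0ℚ) ≃-refl y))

⊝⊑0⇒⊑ : ∀ {x y} → x ⊝ y ⊑ 0ʳ → x ⊑ y
⊝⊑0⇒⊑ {x} {y} h = begin
  x               ≈⟨ solve 2 (λ x y → x := x :- y :+ y) ≃-refl x y ⟩
  x ⊝ y ⊕ y       ≤⟨ ⊕-mono-⊑ h ⊑-refl ⟩
  0ʳ ⊕ y          ≈⟨ ⊕-identityˡ y ⟩
  y               ∎
  where open ⊑-Reasoning

x⊑y⇒0⊑y⊝x : ∀ {x y} → x ⊑ y → 0ʳ ⊑ y ⊝ x
x⊑y⇒0⊑y⊝x {x} {y} h = ⊑-trans (≃⇒⊑ (solve 1 (λ x → con 0ℚ := x :- x) ≃-refl x))
  (⊕-mono-⊑ h (⊑-refl {⊖ x}))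

⊑-stable : ∀ {x y} → ¬ ¬ x ⊑ y → x ⊑ y
⊑-stable h = ⊝⊑0⇒⊑ (⊑0-stable λ k → h λ x⊑y → k (⊑⇒⊝⊑0 x⊑y))

≃-stable : ∀ {x y} → ¬ ¬ x ≃ y → x ≃ y
≃-stable h = ⊑-antisym (⊑-stable λ k → h λ x≃y → k (≃⇒⊑ x≃y))
                       (⊑-stable λ k → h λ x≃y → k (≃⇒⊒ x≃y))

-- If x ⋢ y and y ⋢ x, then (x − y)(y − x) = −(x − y)² is a product of positives.
⋢⇒⊒ : ∀ {x y} → ¬ x ⊑ y → y ⊑ x
⋢⇒⊒ {x} {y} x⋢y = ⊑-stable λ y⋢x →
  ⊗-pos (λ h → x⋢y (⊝⊑0⇒⊑ h)) (λ h → y⋢x (⊝⊑0⇒⊑ h)) (begin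
    (x ⊝ y) ⊗ (y ⊝ x)          ≈⟨ solve 2 (λ x y → (x :- y) :* (y :- x) := :- ((x :- y) :* (x :- y)))
                                    ≃-refl x y ⟩
    ⊖ ((x ⊝ y) ⊗ (x ⊝ y))      ≤⟨ ⊖-anti-⊑ (0⊑x⊗x (x ⊝ y)) ⟩
    ⊖ 0ʳ                       ≈⟨ solve 0 (:- con 0ℚ := con 0ℚ) ≃-refl ⟩
    0ʳ                         ∎)
  where open ⊑-Reasoning

-- Terms of either sequence may be slightly negative, so the proof goes by cases: a factor that is
-- `⊑ 0ʳ` vanishes, and otherwise `⊗-pos` applies.
⊗-nonNeg : ∀ {x y} → 0ʳ ⊑ x → 0ʳ ⊑ y → 0ʳ ⊑ x ⊗ y
⊗-nonNeg {x} {y} 0⊑x 0⊑y = ⊑-stable λ ¬0⊑xy →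
  ¬¬-excluded-middle λ where
    (yes x⊑0) → ¬0⊑xy (≃⇒⊒ (≃-trans (⊗-cong (⊑-antisym x⊑0 0⊑x) ≃-refl)
                  (solve 1 (λ y → con 0ℚ :* y := con 0ℚ) ≃-refl y)))
    (no  x⋢0) → ¬¬-excluded-middle λ where
      (yes y⊑0) → ¬0⊑xy (≃⇒⊒ (≃-trans (⊗-cong ≃-refl (⊑-antisym y⊑0 0⊑y))
                    (solve 1 (λ x → x :* con 0ℚ := con 0ℚ) ≃-refl x)))
      (no  y⋢0) → ¬0⊑xy (⋢⇒⊒ (⊗-pos x⋢0 y⋢0))

⊗-monoˡ-⊑ : ∀ {x y z} → 0ʳ ⊑ z → x ⊑ y → z ⊗ x ⊑ z ⊗ y
⊗-monoˡ-⊑ {x} {y} {z} 0⊑z x⊑y = ⊝⊑0⇒⊑ (begin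
  z ⊗ x ⊝ z ⊗ y              ≈⟨ solve 3 (λ x y z → z :* x :- z :* y := :- (z :* (y :- x)))
                                  ≃-refl x y z ⟩
  ⊖ (z ⊗ (y ⊝ x))            ≤⟨ ⊖-anti-⊑ (⊗-nonNeg 0⊑z (x⊑y⇒0⊑y⊝x x⊑y)) ⟩
  ⊖ 0ʳ                       ≈⟨ solve 0 (:- con 0ℚ := con 0ℚ) ≃-refl ⟩
  0ʳ                         ∎)
  where open ⊑-Reasoning

-- Otherwise `z` and `x ⊝ y` would both be positive, and so would their product.
⊗-cancelˡ-⊑ : ∀ {x y z} → ¬ z ⊑ 0ʳ → z ⊗ x ⊑ z ⊗ y → x ⊑ y
⊗-cancelˡ-⊑ {x} {y} {z} z⋢0 zx⊑zy = ⊑-stable λ x⋢y →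
  ⊗-pos z⋢0 (λ h → x⋢y (⊝⊑0⇒⊑ h)) (begin
    z ⊗ (x ⊝ y)       ≈⟨ solve 3 (λ x y z → z :* (x :- y) := z :* x :- z :* y) ≃-refl x y z ⟩
    z ⊗ x ⊝ z ⊗ y     ≤⟨ ⊑⇒⊝⊑0 zx⊑zy ⟩
    0ʳ                ∎)
  where open ⊑-Reasoning

⊗-cancelˡ-≃ : ∀ {x y z} → ¬ z ⊑ 0ʳ → z ⊗ x ≃ z ⊗ y → x ≃ y
⊗-cancelˡ-≃ z⋢0 h = ⊑-antisym (⊗-cancelˡ-⊑ z⋢0 (≃⇒⊑ h)) (⊗-cancelˡ-⊑ z⋢0 (≃⇒⊒ h))

-- If `x` or `⊖ x` were positive, its square would be as well.
square⊑0⇒≃0 : ∀ {x} → x ⊗ x ⊑ 0ʳ → x ≃ 0ʳ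
square⊑0⇒≃0 {x} x²⊑0 = ≃-stable λ x≄0 → ¬¬-excluded-middle λ where
    (no  x⋢0) → ⊗-pos x⋢0 x⋢0 x²⊑0
    (yes x⊑0) → ¬¬-excluded-middle λ where
      (no  ⊖x⋢0) → ⊗-pos ⊖x⋢0 ⊖x⋢0
        (⊑-trans (≃⇒⊑ (solve 1 (λ x → :- x :* :- x := x :* x) ≃-refl x)) x²⊑0)
      (yes ⊖x⊑0) → x≄0 (⊑-antisym x⊑0 (begin
        0ʳ          ≈⟨ solve 0 (con 0ℚ := :- con 0ℚ) ≃-refl ⟩
        ⊖ 0ʳ        ≤⟨ ⊖-anti-⊑ ⊖x⊑0 ⟩
        ⊖ (⊖ x)     ≈⟨ solve 1 (λ x → :- (:- x) := x) ≃-refl x ⟩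
        x           ∎))
  where open ⊑-Reasoning

-- If `x ⋢ y`, then `x ⊝ y` is positive, and so is `x ⊕ y`, as otherwise `x ⊑ ⊖ y ⊑ 0ʳ ⊑ y`. Their
-- product is the difference of the squares.
square-cancel-⊑ : ∀ {x y} → 0ʳ ⊑ y → x ⊗ x ⊑ y ⊗ y → x ⊑ y
square-cancel-⊑ {x} {y} 0⊑y x²⊑y² = ⊑-stable λ x⋢y → ⊗-pos (λ h → x⋢y (⊝⊑0⇒⊑ h))
  (λ x+y⊑0 → x⋢y (begin
    x                 ≈⟨ solve 2 (λ x y → x := x :+ y :- y) ≃-refl x y ⟩
    x ⊕ y ⊝ y         ≤⟨ ⊕-mono-⊑ x+y⊑0 (⊖-anti-⊑ 0⊑y) ⟩
    0ʳ ⊝ 0ʳ           ≈⟨ solve 0 (con 0ℚ :- con 0ℚ := con 0ℚ) ≃-refl ⟩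
    0ʳ                ≤⟨ 0⊑y ⟩
    y                 ∎))
  (begin
    (x ⊝ y) ⊗ (x ⊕ y)   ≈⟨ solve 2 (λ x y → (x :- y) :* (x :+ y) := x :* x :- y :* y) ≃-refl x y ⟩
    x ⊗ x ⊝ y ⊗ y       ≤⟨ ⊑⇒⊝⊑0 x²⊑y² ⟩
    0ʳ                  ∎)
  where open ⊑-Reasoning

-- Square roots

module _ where
  open import Data.Rational.Base using (_+_; _*_; -_; _-_; _≤_; _<_; ∣_∣)
  open ℚ.≤-Reasoning

  -- The rounding error of √ℚ, as a real equal to 0.
  δ : ℝ
  δ .seq = 1/1+
  δ .cauchy e 0<e = ↧ₙ e , λ m n h k → close {1/1+ m} {1/1+ n} {e} (near m n h) (near n m k)
    where
    near : ∀ m n → ↧ₙ e ℕ.≤ m → 1/1+ m ≤ 1/1+ n + e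
    near m n h = begin
      1/1+ m        ≤⟨ 1/1+-small 0<e h ⟩
      e             ≡⟨ ℚ.+-identityˡ e ⟨
      0ℚ + e        ≤⟨ ℚ.+-monoˡ-≤ e (1/1+-nonNeg n) ⟩
      1/1+ n + e    ∎

  opaque
    unfolding ι

    δ≃0 : δ ≃ 0ʳ
    δ≃0 = ⊑-antisym
      (mk λ e 0<e → ↧ₙ e , λ n h →
        ℚ.≤-trans (1/1+-small 0<e h) (ℚ.≤-reflexive (≡.sym (ℚ.+-identityˡ e))))
      (⊑-pointwise 1/1+-nonNeg)

    √-nonNeg : ∀ x → 0ʳ ⊑ √ x
    √-nonNeg x = ⊑-pointwise λ n → √ℚ-nonNeg n (seq x n)

    x⊑[√x⊕δ]² : ∀ x → x ⊑ (√ x ⊕ δ) ⊗ (√ x ⊕ δ)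
    x⊑[√x⊕δ]² x = ⊑-pointwise λ n → ℚ.<⇒≤ (√ℚ-upper n (seq x n))

    √x²⊑x : ∀ {x} → 0ʳ ⊑ x → √ x ⊗ √ x ⊑ x
    √x²⊑x {x} (mk h) = mk λ e 0<e → let N , p = h e 0<e in N , λ n N≤n →
      go n e 0<e (p n N≤n) (√ℚ-lower n (seq x n))
      where
      go : ∀ n e → 0ℚ < e → 0ℚ ≤ seq x n + e →
           √ℚ n (seq x n) ≡ 0ℚ ⊎ √ℚ n (seq x n) * √ℚ n (seq x n) ≤ seq x n →
           √ℚ n (seq x n) * √ℚ n (seq x n) ≤ seq x n + e
      -- A rounded root of 0 also arises when `seq x n` is negative; the hypothesis `0ʳ ⊑ x` bounds
      -- how negative it can be.
      go n e 0<e 0≤ (inj₁ eq) = ℚ.≤-trans (ℚ.≤-reflexive (≡.cong₂ _*_ eq eq)) 0≤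
      go n e 0<e 0≤ (inj₂ s²≤) = ℚ.≤-trans s²≤ (p≤p+e 0<e)

√-square : ∀ x → 0ʳ ⊑ x → √ x ⊗ √ x ≃ x
√-square x 0⊑x = ⊑-antisym (√x²⊑x 0⊑x) (begin
  x                           ≤⟨ x⊑[√x⊕δ]² x ⟩
  (√ x ⊕ δ) ⊗ (√ x ⊕ δ)       ≈⟨ ⊗-cong step step ⟩
  √ x ⊗ √ x                   ∎)
  where
  open ⊑-Reasoning
  step : √ x ⊕ δ ≃ √ x
  step = ≃-trans (⊕-cong ≃-refl δ≃0) (solve 1 (λ x → x :+ con 0ℚ := x) ≃-refl (√ x))

-- Complex numbers

infix  4 _≋_
infixl 6 _⊞_
infixl 7 _⊠_
infix  8 ⊟_

record _≋_ (z w : ℂ) : Set where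
  constructor mk
  field
    re-≃ : re z ≃ re w
    im-≃ : im z ≃ im w

open _≋_

cx : ℝ → ℂ
cx x = x +i 0ʳ

_⊞_ _⊠_ : ℂ → ℂ → ℂ
z ⊞ w = (re z ⊕ re w) +i (im z ⊕ im w)
z ⊠ w = (re z ⊗ re w ⊝ im z ⊗ im w) +i (re z ⊗ im w ⊕ im z ⊗ re w)

⊟_ conj : ℂ → ℂ
⊟ z = (⊖ re z) +i (⊖ im z)
conj z = re z +i (⊖ im z)

∥_∥² : ℂ → ℝ
∥ z ∥² = re z ⊗ re z ⊕ im z ⊗ im z

≋-setoid : Setoid 0ℓ 0ℓ
≋-setoid = record
  { Carrier = ℂ ; _≈_ = _≋_
  ; isEquivalence = record
    { refl = mk ≃-refl ≃-refl
    ; sym = λ (mk p q) → mk (≃-sym p) (≃-sym q)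
    ; trans = λ (mk p q) (mk p′ q′) → mk (≃-trans p p′) (≃-trans q q′) } }

open Setoid ≋-setoid using () renaming (refl to ≋-refl; sym to ≋-sym; trans to ≋-trans)

module ≋-Reasoning where
  open import Relation.Binary.Reasoning.Setoid ≋-setoid public

⊞-cong : ∀ {z w u v} → z ≋ w → u ≋ v → z ⊞ u ≋ w ⊞ v
⊞-cong (mk p q) (mk p′ q′) = mk (⊕-cong p p′) (⊕-cong q q′)

⊟-cong : ∀ {z w} → z ≋ w → ⊟ z ≋ ⊟ w
⊟-cong (mk p q) = mk (⊖-cong p) (⊖-cong q)

⊠-cong : ∀ {z w u v} → z ≋ w → u ≋ v → z ⊠ u ≋ w ⊠ v
⊠-cong (mk p q) (mk p′ q′) =
  mk (⊕-cong (⊗-cong p p′) (⊖-cong (⊗-cong q q′))) (⊕-cong (⊗-cong p q′) (⊗-cong q p′))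

ℂ-commutativeRing : CommutativeRing 0ℓ 0ℓ
ℂ-commutativeRing = record
  { Carrier = ℂ ; _≈_ = _≋_ ; _+_ = _⊞_ ; _*_ = _⊠_ ; -_ = ⊟_ ; 0# = cx 0ʳ ; 1# = cx 1ʳ
  ; isCommutativeRing = record
    { isRing = record
      { +-isAbelianGroup = record
        { isGroup = record
          { isMonoid = record
            { isSemigroup = record
              { isMagma = record
                { isEquivalence = Setoid.isEquivalence ≋-setoid ; ∙-cong = ⊞-cong }
              ; assoc = λ z w u → mk (⊕-assoc (re z) (re w) (re u))
                                     (⊕-assoc (im z) (im w) (im u)) }
            ; identity = comm∧idˡ⇒id ⊞-comm λ z → mk (⊕-identityˡ (re z)) (⊕-identityˡ (im z)) }
          ; inverse = comm∧invˡ⇒inv ⊞-comm λ z → mk (⊖-inverseˡ (re z)) (⊖-inverseˡ (im z))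
          ; ⁻¹-cong = ⊟-cong }
        ; comm = ⊞-comm }
      ; *-cong = ⊠-cong
      ; *-assoc = λ (a +i b) (c +i d) (e +i f) → mk
          (solve 6 (λ a b c d e f → (a :* c :- b :* d) :* e :- (a :* d :+ b :* c) :* f :=
             a :* (c :* e :- d :* f) :- b :* (c :* f :+ d :* e)) ≃-refl a b c d e f)
          (solve 6 (λ a b c d e f → (a :* c :- b :* d) :* f :+ (a :* d :+ b :* c) :* e :=
             a :* (c :* f :+ d :* e) :+ b :* (c :* e :- d :* f)) ≃-refl a b c d e f)
      ; *-identity = comm∧idˡ⇒id ⊠-comm λ (a +i b) → mk
          (solve 2 (λ a b → con 1ℚ :* a :- con 0ℚ :* b := a) ≃-refl a b)
          (solve 2 (λ a b → con 1ℚ :* b :+ con 0ℚ :* a := b) ≃-refl a b)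
      ; distrib = comm∧distrˡ⇒distr ⊞-cong ⊠-comm λ (a +i b) (c +i d) (e +i f) → mk
          (solve 6 (λ a b c d e f → a :* (c :+ e) :- b :* (d :+ f) :=
             a :* c :- b :* d :+ (a :* e :- b :* f)) ≃-refl a b c d e f)
          (solve 6 (λ a b c d e f → a :* (d :+ f) :+ b :* (c :+ e) :=
             a :* d :+ b :* c :+ (a :* f :+ b :* e)) ≃-refl a b c d e f) }
    ; *-comm = ⊠-comm } }
  where
  open import Algebra.Consequences.Setoid ≋-setoid
  ⊞-comm : ∀ z w → z ⊞ w ≋ w ⊞ z
  ⊞-comm z w = mk (⊕-comm (re z) (re w)) (⊕-comm (im z) (im w))
  ⊠-comm : ∀ z w → z ⊠ w ≋ w ⊠ z
  ⊠-comm (a +i b) (c +i d) = mk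
    (solve 4 (λ a b c d → a :* c :- b :* d := c :* a :- d :* b) ≃-refl a b c d)
    (solve 4 (λ a b c d → a :* d :+ b :* c := c :* b :+ d :* a) ≃-refl a b c d)

module ℂᵣ = CommutativeRing ℂ-commutativeRing
module ℝᵣ = CommutativeRing ℝ-commutativeRing

∥∥²-cong : ∀ {z w} → z ≋ w → ∥ z ∥² ≃ ∥ w ∥²
∥∥²-cong (mk p q) = ⊕-cong (⊗-cong p p) (⊗-cong q q)

∥∥²-nonNeg : ∀ z → 0ʳ ⊑ ∥ z ∥²
∥∥²-nonNeg z = ⊑-trans (≃⇒⊒ (⊕-identityˡ 0ʳ)) (⊕-mono-⊑ (0⊑x⊗x (re z)) (0⊑x⊗x (im z)))

∥∥²-⊠ : ∀ z w → ∥ z ⊠ w ∥² ≃ ∥ z ∥² ⊗ ∥ w ∥²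
∥∥²-⊠ (a +i b) (c +i d) = solve 4 (λ a b c d →
  (a :* c :- b :* d) :* (a :* c :- b :* d) :+ (a :* d :+ b :* c) :* (a :* d :+ b :* c) :=
  (a :* a :+ b :* b) :* (c :* c :+ d :* d)) ≃-refl a b c d

x⊕y⊑0⇒x⊑0 : ∀ {x y} → 0ʳ ⊑ y → x ⊕ y ⊑ 0ʳ → x ⊑ 0ʳ
x⊕y⊑0⇒x⊑0 {x} {y} 0⊑y x+y⊑0 = ⊑-trans (≃⇒⊑ (ℝᵣ.sym (ℝᵣ.+-identityʳ x)))
  (⊑-trans (⊕-mono-⊑ ⊑-refl 0⊑y) x+y⊑0)

x⊕y⊑0⇒y⊑0 : ∀ {x y} → 0ʳ ⊑ x → x ⊕ y ⊑ 0ʳ → y ⊑ 0ʳ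
x⊕y⊑0⇒y⊑0 {x} {y} 0⊑x x+y⊑0 = x⊕y⊑0⇒x⊑0 0⊑x (⊑-trans (≃⇒⊑ (⊕-comm y x)) x+y⊑0)

∥z∥²⊑0⇒z≋0 : ∀ {z} → ∥ z ∥² ⊑ 0ʳ → z ≋ cx 0ʳ
∥z∥²⊑0⇒z≋0 {z} h = mk (square⊑0⇒≃0 (x⊕y⊑0⇒x⊑0 (0⊑x⊗x (im z)) h))
                      (square⊑0⇒≃0 (x⊕y⊑0⇒y⊑0 (0⊑x⊗x (re z)) h))

z⊟w≋0⇒z≋w : ∀ {z w} → z ⊞ ⊟ w ≋ cx 0ʳ → z ≋ w
z⊟w≋0⇒z≋w {z} {w} h = begin
  z                  ≈⟨ ℂᵣ.+-identityʳ z ⟨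
  z ⊞ cx 0ʳ          ≈⟨ ⊞-cong ≋-refl (ℂᵣ.-‿inverseˡ w) ⟨
  z ⊞ (⊟ w ⊞ w)      ≈⟨ ℂᵣ.+-assoc z (⊟ w) w ⟨
  z ⊞ ⊟ w ⊞ w        ≈⟨ ⊞-cong h ≋-refl ⟩
  cx 0ʳ ⊞ w          ≈⟨ ℂᵣ.+-identityˡ w ⟩
  w                  ∎
  where open ≋-Reasoning

-- Norms are multiplicative, which turns cancellation of `u` into cancellation of the positive real
-- `∥ u ∥²`.
⊠-cancelʳ : ∀ {z w u} → ¬ ∥ u ∥² ⊑ 0ʳ → z ⊠ u ≋ w ⊠ u → z ≋ w
⊠-cancelʳ {z} {w} {u} u≄0 zu≋wu = z⊟w≋0⇒z≋w (∥z∥²⊑0⇒z≋0 (⊗-cancelˡ-⊑ u≄0 (begin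
  ∥ u ∥² ⊗ ∥ z ⊞ ⊟ w ∥²           ≈⟨ ∥∥²-⊠ u (z ⊞ ⊟ w) ⟨
  ∥ u ⊠ (z ⊞ ⊟ w) ∥²              ≈⟨ ∥∥²-cong u[z-w]≋0 ⟩
  ∥ cx 0ʳ ∥²                      ≈⟨ solve 1 (λ x → con 0ℚ :* con 0ℚ :+ con 0ℚ :* con 0ℚ := x :* con 0ℚ)
                                       ≃-refl ∥ u ∥² ⟩
  ∥ u ∥² ⊗ 0ʳ                     ∎)))
  where
  open ⊑-Reasoning
  u[z-w]≋0 : u ⊠ (z ⊞ ⊟ w) ≋ cx 0ʳ
  u[z-w]≋0 = ≋-trans (ℂᵣ.distribˡ u z (⊟ w)) (≋-trans
    (⊞-cong (≋-trans (ℂᵣ.*-comm u z) (≋-trans zu≋wu (ℂᵣ.*-comm w u)))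
            (≋-sym (-‿distribʳ-* u w)))
    (ℂᵣ.-‿inverseʳ (u ⊠ w)))
    where open import Algebra.Properties.Ring ℂᵣ.ring using (-‿distribʳ-*)

≋-stable : ∀ {z w} → ¬ ¬ z ≋ w → z ≋ w
≋-stable h = mk (≃-stable λ k → h λ z≋w → k (re-≃ z≋w)) (≃-stable λ k → h λ z≋w → k (im-≃ z≋w))

-- Finite sums and maxima

module ℝ∑ = Sum ℝᵣ.semiring
module ℂ∑ = Sum ℂᵣ.semiring

∑-nonNeg : ∀ {n} {f : Vector ℝ n} → (∀ i → 0ʳ ⊑ f i) → 0ʳ ⊑ ℝ∑.sum f
∑-nonNeg {zero}  h = ⊑-refl
∑-nonNeg {suc n} h = ⊑-trans (≃⇒⊒ (⊕-identityˡ 0ʳ)) (⊕-mono-⊑ (h zero) (∑-nonNeg λ i → h (suc i)))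

∑⊑0⇒⊑0 : ∀ {n} {f : Vector ℝ n} → (∀ i → 0ʳ ⊑ f i) → ℝ∑.sum f ⊑ 0ʳ → ∀ i → f i ⊑ 0ʳ
∑⊑0⇒⊑0 {suc n} h ∑⊑0 zero    = x⊕y⊑0⇒x⊑0 (∑-nonNeg λ i → h (suc i)) ∑⊑0
∑⊑0⇒⊑0 {suc n} h ∑⊑0 (suc i) = ∑⊑0⇒⊑0 (λ i → h (suc i)) (x⊕y⊑0⇒y⊑0 (h zero) ∑⊑0) i

re-∑ : ∀ {n} (f : Vector ℂ n) → re (ℂ∑.sum f) ≃ ℝ∑.sum (λ i → re (f i))
re-∑ {zero}  f = ≃-refl
re-∑ {suc n} f = ⊕-cong ≃-refl (re-∑ λ i → f (suc i))

-- Comparing two reals is not decidable, but excluded middle is available under a double negation;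
-- each step compares the head with the maximum of the tail.
¬¬maximum : ∀ {n} (f : Vector ℝ n) → Fin n → ¬ ¬ (∃[ i ] ∀ j → f j ⊑ f i)
¬¬maximum {suc zero}    f _ k = k (zero , λ { zero → ⊑-refl })
¬¬maximum {suc (suc n)} f _ k = ¬¬maximum (λ i → f (suc i)) zero λ (i , max) →
  ¬¬-excluded-middle λ where
    (yes f₀⊑fᵢ) → k (suc i , λ { zero → f₀⊑fᵢ ; (suc j) → max j })
    (no  f₀⋢fᵢ) → k (zero , λ { zero → ⊑-refl ; (suc j) → ⊑-trans (max j) (⋢⇒⊒ f₀⋢fᵢ) })

-- The operations of Defs on ℂ agree with the ones above once ι, ⊕, ⊗ and ⊖ are unfolded.
opaque
  unfolding ι

  fromℚ≡ι : ∀ q → fromℚ q ≡ ι q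
  fromℚ≡ι q = ≡.refl

  +ʳ≡⊕ : _+ʳ_ ≡ _⊕_
  +ʳ≡⊕ = ≡.refl

  *ʳ≡⊗ : _*ʳ_ ≡ _⊗_
  *ʳ≡⊗ = ≡.refl

  -ʳ≡⊖ : -ʳ_ ≡ ⊖_
  -ʳ≡⊖ = ≡.refl

  0ᶜ≡cx0 : 0ᶜ ≡ cx 0ʳ
  0ᶜ≡cx0 = ≡.refl

  1ᶜ≡cx1 : 1ᶜ ≡ cx 1ʳ
  1ᶜ≡cx1 = ≡.refl

≈ᶜ⇒≋ : ∀ {z w} → z ≈ᶜ w → z ≋ w
≈ᶜ⇒≋ (p , q) = mk (mk p) (mk q)

≋⇒≈ᶜ : ∀ {z w} → z ≋ w → z ≈ᶜ w
≋⇒≈ᶜ (mk (mk p) (mk q)) = p , q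

1ᶜ≋1 : 1ᶜ ≋ cx 1ʳ
1ᶜ≋1 = ℂᵣ.reflexive 1ᶜ≡cx1

+ᶜ≡⊞ : ∀ z w → z +ᶜ w ≡ z ⊞ w
+ᶜ≡⊞ z w = ≡.cong (λ _+_ → (re z + re w) +i (im z + im w)) +ʳ≡⊕

-ᶜ≡⊟ : ∀ z → -ᶜ z ≡ ⊟ z
-ᶜ≡⊟ z = ≡.cong (λ -_ → (- re z) +i (- im z)) -ʳ≡⊖

*ᶜ≡⊠ : ∀ z w → z *ᶜ w ≡ z ⊠ w
*ᶜ≡⊠ z w = ≡.trans
  (≡.cong (λ _+_ → ((re z *ʳ re w) + (-ʳ (im z *ʳ im w))) +i ((re z *ʳ im w) + (im z *ʳ re w))) +ʳ≡⊕)
  (≡.trans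
    (≡.cong (λ -_ → (re z *ʳ re w ⊕ (- (im z *ʳ im w))) +i (re z *ʳ im w ⊕ im z *ʳ re w)) -ʳ≡⊖)
    (≡.cong (λ _*_ → (re z * re w ⊝ im z * im w) +i (re z * im w ⊕ im z * re w)) *ʳ≡⊗))

∣z∣ᶜ≡√ : ∀ z → ∣ z ∣ᶜ ≡ √ ∥ z ∥²
∣z∣ᶜ≡√ z = go ∥ z ∥² (≡.trans
  (≡.cong (λ _+_ → (re z *ʳ re z) + (im z *ʳ im z)) +ʳ≡⊕)
  (≡.cong (λ _*_ → (re z * re z) ⊕ (im z * im z)) *ʳ≡⊗))
  where
  go : ∀ x → re z *ʳ re z +ʳ im z *ʳ im z ≡ x → ∣ z ∣ᶜ ≡ √ x
  go _ ≡.refl = ≡.refl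

foldr-cong : ∀ {A : Set} {_∙_ _∘_ : A → A → A} {d e : A} → (∀ x y → x ∙ y ≡ x ∘ y) → d ≡ e →
             ∀ {n} {f g : Vector A n} → (∀ i → f i ≡ g i) →
             Vector.foldr _∙_ d f ≡ Vector.foldr _∘_ e g
foldr-cong ∙≡∘ d≡e {zero}  f≡g = d≡e
foldr-cong {_∘_ = _∘_} ∙≡∘ d≡e {suc n} f≡g = ≡.trans (∙≡∘ _ _)
  (≡.cong₂ _∘_ (f≡g zero) (foldr-cong ∙≡∘ d≡e λ i → f≡g (suc i)))

·ᵥ≡∑ : ∀ {n} (M : Matrix n) (v : Vector ℂ n) s → (M ·ᵥ v) s ≡ ℂ∑.sum (λ t → M s t ⊠ v t)
·ᵥ≡∑ M v s = foldr-cong {ℂ} {_+ᶜ_} {_⊞_} {0ᶜ} {cx 0ʳ} +ᶜ≡⊞ 0ᶜ≡cx0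
  {f = λ t → M s t *ᶜ v t} {g = λ t → M s t ⊠ v t} λ t → *ᶜ≡⊠ (M s t) (v t)

∣z∣²≃∥z∥² : ∀ z → ∣ z ∣ᶜ ⊗ ∣ z ∣ᶜ ≃ ∥ z ∥²
∣z∣²≃∥z∥² z = ≡.subst (λ r → r ⊗ r ≃ ∥ z ∥²) (≡.sym (∣z∣ᶜ≡√ z)) (√-square ∥ z ∥² (∥∥²-nonNeg z))

∣z∣-nonNeg : ∀ z → 0ʳ ⊑ ∣ z ∣ᶜ
∣z∣-nonNeg z = ≡.subst (0ʳ ⊑_) (≡.sym (∣z∣ᶜ≡√ z)) (√-nonNeg ∥ z ∥²)

-- Gains of walks

module ℂ* = CommutativeMonoidSolver ℂᵣ.*-commutativeMonoid
open ℂ* using (_⊜_) renaming (_⊕_ to _⊛_)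

module Gain {n : ℕ} {G : Graph n} (Φ : GainGraph G) where
  open Graph G
  open GainGraph Φ
  open ≋-Reasoning
  open DecMembership (Fin._≟_ {n}) using (_∈?_)

  gain-◅ : ∀ {s t r} (e : s ~ t) (w : Walk t r) → gain (e ◅ w) ≋ φ s t e ⊠ gain w
  gain-◅ {s} {t} e w = ℂᵣ.reflexive (*ᶜ≡⊠ (φ s t e) (gain w))

  gain-◅◅ : ∀ {s t r} (w : Walk s t) (w′ : Walk t r) → gain (w ◅◅ w′) ≋ gain w ⊠ gain w′
  gain-◅◅ ε w′ = begin
    gain w′                ≈⟨ ℂᵣ.*-identityˡ (gain w′) ⟨
    cx 1ʳ ⊠ gain w′        ≈⟨ ⊠-cong 1ᶜ≋1 ≋-refl ⟨
    1ᶜ   ⊠ gain w′       ∎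
  gain-◅◅ (_◅_ {s} {t} e w) w′ = begin
    gain (e ◅ (w ◅◅ w′))               ≈⟨ gain-◅ e (w ◅◅ w′) ⟩
    φ s t e ⊠ gain (w ◅◅ w′)           ≈⟨ ⊠-cong ≋-refl (gain-◅◅ w w′) ⟩
    φ s t e ⊠ (gain w ⊠ gain w′)       ≈⟨ ℂᵣ.*-assoc (φ s t e) (gain w) (gain w′) ⟨
    φ s t e ⊠ gain w ⊠ gain w′         ≈⟨ ⊠-cong (gain-◅ e w) ≋-refl ⟨
    gain (e ◅ w) ⊠ gain w′             ∎

  φφ⁻¹≋1 : ∀ {s t} (e : s ~ t) (e′ : t ~ s) → φ t s e′ ⊠ φ s t e ≋ cx 1ʳ
  φφ⁻¹≋1 {s} {t} e e′ = begin
    φ t s e′ ⊠ φ s t e        ≡⟨ *ᶜ≡⊠ (φ t s e′) (φ s t e) ⟨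
    φ t s e′ *ᶜ φ s t e       ≈⟨ ≈ᶜ⇒≋ (inv s t e) ⟩
    1ᶜ                        ≡⟨ 1ᶜ≡cx1 ⟩
    cx 1ʳ                     ∎

  -- Includes the end, unlike `visited`: distinct `vertices` make a walk a path, while distinct
  -- `visited` allow it to close up.
  vertices : ∀ {s t} → Walk s t → List (Fin n)
  vertices {s} ε       = s ∷ []
  vertices {s} (_ ◅ w) = s ∷ vertices w

  end∈vertices : ∀ {s t} (w : Walk s t) → t ∈ vertices w
  end∈vertices ε       = here ≡.refl
  end∈vertices (_ ◅ w) = there (end∈vertices w)

  -- The cut of a path `p` at one of its vertices `x`, as loop erasure needs it: `before` closes up
  -- when preceded by an edge from `x` to `s`, and `after` is the path that is kept. `subset` serves
  -- the recursion, which derives `distinct` from it.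
  record Split {s t} (x : Fin n) (p : Walk s t) : Set₁ where
    field
      before   : Walk s x
      after    : Walk x t
      gain-≋   : gain p ≋ gain before ⊠ gain after
      subset   : ∀ {P : Fin n → Set} → All P (vertices p) → All P (visited before)
      distinct : Unique (visited before)
      avoids   : All (x ≢_) (visited before)
      unique   : Unique (vertices after)

  split : ∀ {s t x} (p : Walk s t) → Unique (vertices p) → x ∈ vertices p → Split x p
  split {s} ε u (here ≡.refl) = record
    { before = ε ; after = ε ; gain-≋ = gain-◅◅ {s} ε ε ; subset = λ _ → []
    ; distinct = [] ; avoids = [] ; unique = u }
  split (e ◅ p) u (here ≡.refl) = record
    { before = ε ; after = e ◅ p ; gain-≋ = gain-◅◅ ε (e ◅ p) ; subset = λ _ → []
    ; distinct = [] ; avoids = [] ; unique = u }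
  split (e ◅ p) (s∉p ∷ u) (there x∈p) = record
    { before = e ◅ before ; after = after
    ; gain-≋ = ≋-trans (gain-◅ e p) (≋-trans (⊠-cong ≋-refl gain-≋)
        (≋-trans (≋-sym (ℂᵣ.*-assoc _ (gain before) (gain after)))
          (⊠-cong (≋-sym (gain-◅ e before)) ≋-refl)))
    ; subset = λ { (px ∷ pxs) → px ∷ subset pxs }
    ; distinct = subset s∉p ∷ distinct
    ; avoids = (λ x≡s → All.lookup s∉p x∈p (≡.sym x≡s)) ∷ avoids
    ; unique = unique }
    where open Split (split p u x∈p)

  module _ (balanced : Balanced) where

    -- A `DirectedCycle` has at least three vertices, so shorter closed walks are treated apart: a
    -- loop is excluded by irreflexivity, and an edge traversed back and forth has gain 1 by `inv`.
    cycle-gain : ∀ {s x} (e : x ~ s) (w : Walk s x) → All (x ≢_) (visited w) →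
                 Unique (visited w) → gain (e ◅ w) ≋ cx 1ʳ
    cycle-gain e ε _ _ = ⊥-elim (~-irrefl ≡.refl e)
    cycle-gain {s} {x} e (e′ ◅ ε) _ _ = begin
      gain (e ◅ e′ ◅ ε)                    ≈⟨ gain-◅ e (e′ ◅ ε) ⟩
      φ x s e ⊠ gain (e′ ◅ ε)              ≈⟨ ⊠-cong ≋-refl (gain-◅ e′ ε) ⟩
      φ x s e ⊠ (φ s x e′ ⊠ 1ᶜ)        ≈⟨ ⊠-cong ≋-refl (⊠-cong ≋-refl 1ᶜ≋1) ⟩
      φ x s e ⊠ (φ s x e′ ⊠ cx 1ʳ)         ≈⟨ ⊠-cong ≋-refl (ℂᵣ.*-identityʳ (φ s x e′)) ⟩
      φ x s e ⊠ φ s x e′                   ≈⟨ φφ⁻¹≋1 e′ e ⟩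
      cx 1ʳ                                ∎
    cycle-gain {s} {x} e w@(_ ◅ _ ◅ _) x∉w u = begin
      gain (e ◅ w)    ≈⟨ ≈ᶜ⇒≋ (balanced record
                           { base = x ; walk = e ◅ w ; distinct = x∉w ∷ u
                           ; 3≤length = ℕ.s≤s (ℕ.s≤s (ℕ.s≤s ℕ.z≤n)) }) ⟩
      1ᶜ              ≡⟨ 1ᶜ≡cx1 ⟩
      cx 1ʳ           ∎

    -- If prepending an edge returns to a vertex `s` of the path, this edge and the part before `s`
    -- close up with gain 1 and are cut out.
    loop-erasure : ∀ {s t} (w : Walk s t) →
                   Σ[ p ∈ Walk s t ] gain w ≋ gain p × Unique (vertices p)
    loop-erasure ε = ε , ≋-refl , [] ∷ []
    loop-erasure (_◅_ {s} {t} e w) with loop-erasure w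
    ... | p , w≋p , u with s ∈? vertices p
    ...   | no  s∉p = e ◅ p
                    , ≋-trans (gain-◅ e w) (≋-trans (⊠-cong ≋-refl w≋p) (≋-sym (gain-◅ e p)))
                    , ¬Any⇒All¬ (vertices p) s∉p ∷ u
    ...   | yes s∈p = after , (begin
              gain (e ◅ w)                              ≈⟨ gain-◅ e w ⟩
              φ s t e ⊠ gain w                          ≈⟨ ⊠-cong ≋-refl (≋-trans w≋p gain-≋) ⟩
              φ s t e ⊠ (gain before ⊠ gain after)      ≈⟨ ℂᵣ.*-assoc (φ s t e) _ _ ⟨
              φ s t e ⊠ gain before ⊠ gain after        ≈⟨ ⊠-cong (gain-◅ e before) ≋-refl ⟨
              gain (e ◅ before) ⊠ gain after
                ≈⟨ ⊠-cong (cycle-gain e before avoids distinct) ≋-refl ⟩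
              cx 1ʳ ⊠ gain after                        ≈⟨ ℂᵣ.*-identityˡ (gain after) ⟩
              gain after                                ∎) , unique
      where open Split (split p u s∈p)

    -- Loop erasure leaves only the empty walk, since a nonempty closed walk repeats its base.
    closed-gain : ∀ {s} (w : Walk s s) → gain w ≋ cx 1ʳ
    closed-gain w with loop-erasure w
    ... | ε     , w≋p , _       = ≋-trans w≋p 1ᶜ≋1
    ... | _ ◅ p , _   , s∉p ∷ _ = ⊥-elim (All.lookup s∉p (end∈vertices p) ≡.refl)

    -- Following either walk by `r` gives a closed walk of gain 1, so `gain r` is inverse to both
    -- gains.
    gain-unique : ∀ {s t} → Walk t s → (w w′ : Walk s t) → gain w ≋ gain w′
    gain-unique r w w′ = begin
      gain w                           ≈⟨ ℂᵣ.*-identityʳ (gain w) ⟨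
      gain w ⊠ cx 1ʳ                   ≈⟨ ⊠-cong ≋-refl (closed w′) ⟨
      gain w ⊠ (gain w′ ⊠ gain r)      ≈⟨ ℂ*.solve 3 (λ x y z → x ⊛ (y ⊛ z) ⊜ y ⊛ (x ⊛ z))
                                            ≋-refl (gain w) (gain w′) (gain r) ⟩
      gain w′ ⊠ (gain w ⊠ gain r)      ≈⟨ ⊠-cong ≋-refl (closed w) ⟩
      gain w′ ⊠ cx 1ʳ                  ≈⟨ ℂᵣ.*-identityʳ (gain w′) ⟩
      gain w′                          ∎
      where
      closed : ∀ w → gain w ⊠ gain r ≋ cx 1ʳ
      closed w = ≋-trans (≋-sym (gain-◅◅ w r)) (closed-gain (w ◅◅ r))

  -- A switching function that makes every gain 1, except that its values need not have modulus 1.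
  Harmonic : Vector ℂ n → Set
  Harmonic v = ∀ {s t} (e : s ~ t) → φ s t e ⊠ v t ≋ v s

  balanced⇒harmonic : (∀ s t → Walk s t) → Fin n → Balanced →
                      Σ[ v ∈ Vector ℂ n ] Harmonic v × (∃[ s ] v s ≋ cx 1ʳ)
  balanced⇒harmonic walk base balanced =
      (λ s → gain (walk s base))
    -- The walk chosen from `s`, and the edge `e` followed by the walk chosen from `t`, have the
    -- same ends and hence the same gain.
    , (λ {s} {t} e → ≋-trans (≋-sym (gain-◅ e (walk t base)))
        (gain-unique balanced (walk base s) (e ◅ walk t base) (walk s base)))
    , base , closed-gain balanced (walk base base)

  -- Along a walk the equations for `v` telescope to `gain w ⊠ v r ≋ v s`; on a cycle the nonzero
  -- value at the base cancels.
  harmonic⇒balanced : ∀ v → (∀ s → ¬ ∥ v s ∥² ⊑ 0ʳ) → Harmonic v → Balanced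
  harmonic⇒balanced v v≢0 harmonic C = ≋⇒≈ᶜ (≋-trans
    (⊠-cancelʳ (v≢0 base) (≋-trans (transport walk) (≋-sym (ℂᵣ.*-identityˡ (v base)))))
    (≋-sym 1ᶜ≋1))
    where
    open DirectedCycle C
    transport : ∀ {s r} (w : Walk s r) → gain w ⊠ v r ≋ v s
    transport {s} ε = ≋-trans (⊠-cong 1ᶜ≋1 ≋-refl) (ℂᵣ.*-identityˡ (v s))
    transport {r = r} (_◅_ {s} {t} e w) = begin
      gain (e ◅ w) ⊠ v r              ≈⟨ ⊠-cong (gain-◅ e w) ≋-refl ⟩
      φ s t e ⊠ gain w ⊠ v r          ≈⟨ ℂᵣ.*-assoc (φ s t e) (gain w) (v r) ⟩
      φ s t e ⊠ (gain w ⊠ v r)        ≈⟨ ⊠-cong ≋-refl (transport w) ⟩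
      φ s t e ⊠ v t                   ≈⟨ harmonic e ⟩
      v s                             ∎

-- Eigenvectors

2ʳ : ℝ
2ʳ = ι (1ℚ ℚ.+ 1ℚ)

indicator : ∀ {P : Set} → Dec P → ℝ
indicator (yes _) = 1ʳ
indicator (no  _) = 0ʳ

-- Puts the degree in the form of a sum over all vertices, to be combined with the row sums of `A`.
length-filter≃∑ : ∀ {A : Set} {P : Pred A 0ℓ} (P? : Decidable P) {n} (f : Fin n → A) →
  ι (fromℕ (length (filter P? (tabulate f)))) ≃ ℝ∑.sum (λ i → indicator (P? (f i)))
length-filter≃∑ P? {zero}  f = ≃-refl
length-filter≃∑ P? {suc n} f with P? (f zero)
... | yes _ = ≃-trans (ι-⊕ _ 1ℚ) (≃-trans (⊕-comm _ _)
  (⊕-cong ≃-refl (length-filter≃∑ P? λ i → f (suc i))))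
... | no  _ = ≃-trans (length-filter≃∑ P? λ i → f (suc i)) (≃-sym (⊕-identityˡ _))

-- The cross term is linear in `w`, so that its sum over a row of `A` can be evaluated by the
-- eigenvalue equation.
∥cw-u∥² : ∀ c w u → ∥ cx c ⊠ w ⊞ ⊟ u ∥² ≃
          c ⊗ c ⊗ ∥ w ∥² ⊕ ∥ u ∥² ⊕ ⊖ (2ʳ ⊗ c) ⊗ re (w ⊠ conj u)
∥cw-u∥² c (a +i b) (d +i e) = solve 5 (λ c a b d e →
    (c :* a :- con 0ℚ :* b :+ :- d) :* (c :* a :- con 0ℚ :* b :+ :- d)
    :+ (c :* b :+ con 0ℚ :* a :+ :- e) :* (c :* b :+ con 0ℚ :* a :+ :- e) :=
    c :* c :* (a :* a :+ b :* b) :+ (d :* d :+ e :* e)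
    :+ :- (con (1ℚ ℚ.+ 1ℚ) :* c) :* (a :* d :- b :* :- e))
  ≃-refl c a b d e

fromℕ-mono-≤ : ∀ {m n} → m ℕ.≤ n → fromℕ m ℚ.≤ fromℕ n
fromℕ-mono-≤ {n = n} ℕ.z≤n = fromℕ-nonNeg n
fromℕ-mono-≤ (ℕ.s≤s m≤n)   = ℚ.+-monoˡ-≤ 1ℚ (fromℕ-mono-≤ m≤n)

fromℕ-cancel-≤ : ∀ {m n} → fromℕ m ℚ.≤ fromℕ n → m ℕ.≤ n
fromℕ-cancel-≤ {m} {n} m≤n = ℕ.≮⇒≥ λ n<m → ℚ.<-irrefl ≡.refl (ℚ.<-≤-trans
  (≡.subst (ℚ._< fromℕ n ℚ.+ 1ℚ) (ℚ.+-identityʳ (fromℕ n))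
    (ℚ.+-monoʳ-< (fromℕ n) (ℚ.positive⁻¹ 1ℚ)))
  (ℚ.≤-trans (fromℕ-mono-≤ n<m) m≤n))

fromℕ-suc-pos : ∀ n → 0ℚ ℚ.< fromℕ (suc n)
fromℕ-suc-pos n = ℚ.<-≤-trans (ℚ.positive⁻¹ 1ℚ) (fromℕ-mono-≤ {1} {suc n} (ℕ.s≤s ℕ.z≤n))

0<p⇒ιp⋢0 : ∀ {p} → 0ℚ ℚ.< p → ¬ ι p ⊑ 0ʳ
0<p⇒ιp⋢0 0<p = positive⇒¬⊑0 0<p ⊑-refl

2ʳ⋢0 : ¬ 2ʳ ⊑ 0ʳ
2ʳ⋢0 = 0<p⇒ιp⋢0 (ℚ.positive⁻¹ (1ℚ ℚ.+ 1ℚ))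

cx-∑ : ∀ {n} (f : Vector ℝ n) → ℂ∑.sum (λ i → cx (f i)) ≋ cx (ℝ∑.sum f)
cx-∑ {zero}  f = ≋-refl
cx-∑ {suc n} f = ≋-trans (⊞-cong ≋-refl (cx-∑ λ i → f (suc i))) (mk ≃-refl (⊕-identityˡ 0ʳ))

∥∥²-⊟ : ∀ z → ∥ ⊟ z ∥² ≃ ∥ z ∥²
∥∥²-⊟ z = solve 2 (λ a b → :- a :* :- a :+ :- b :* :- b := a :* a :+ b :* b) ≃-refl (re z) (im z)

-- `∥ μ ∥² ⊝ re (μ ⊠ μ)` is twice the square of `im μ` and vanishes here, so `μ` is real; then
-- `(c ⊕ re μ) ⊗ (re μ ⊝ c)` vanishes, and its first factor is positive.
∥μ∥²≃c²∧μ²≋c²⇒μ≋c : ∀ {μ c} → ∥ μ ∥² ≃ c ⊗ c → μ ⊠ μ ≋ cx c ⊠ cx c → ¬ c ⊕ re μ ⊑ 0ʳ → μ ≋ cx c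
∥μ∥²≃c²∧μ²≋c²⇒μ≋c {μ} {c} ∥μ∥²≃c² (mk re-μ² _) c+μ⋢0 = mk
  (⊗-cancelˡ-≃ c+μ⋢0 (begin
    (c ⊕ a) ⊗ a
      ≈⟨ solve 3 (λ a b c → (c :+ a) :* a :=
           (c :+ a) :* c :+ ((a :* a :- b :* b) :- (c :* c :- con 0ℚ :* con 0ℚ)) :+ b :* b)
           ≃-refl a b c ⟩
    (c ⊕ a) ⊗ c ⊕ ((a ⊗ a ⊝ b ⊗ b) ⊝ (c ⊗ c ⊝ 0ʳ ⊗ 0ʳ)) ⊕ b ⊗ b
      ≈⟨ ⊕-cong (⊕-cong ≃-refl (⊕-cong re-μ² ≃-refl)) (⊗-cong b≃0 b≃0) ⟩
    (c ⊕ a) ⊗ c ⊕ ((c ⊗ c ⊝ 0ʳ ⊗ 0ʳ) ⊝ (c ⊗ c ⊝ 0ʳ ⊗ 0ʳ)) ⊕ 0ʳ ⊗ 0ʳ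
      ≈⟨ solve 2 (λ x y → x :+ (y :- y) :+ con 0ℚ :* con 0ℚ := x) ≃-refl
           ((c ⊕ a) ⊗ c) (c ⊗ c ⊝ 0ʳ ⊗ 0ʳ) ⟩
    (c ⊕ a) ⊗ c ∎))
  b≃0
  where
  open import Relation.Binary.Reasoning.Setoid ℝ-setoid
  a = re μ
  b = im μ
  b≃0 : b ≃ 0ʳ
  b≃0 = square⊑0⇒≃0 (⊗-cancelˡ-⊑ 2ʳ⋢0 (≃⇒⊑ (begin
    2ʳ ⊗ (b ⊗ b)
      ≈⟨ solve 2 (λ a b → con (1ℚ ℚ.+ 1ℚ) :* (b :* b) :=
           (a :* a :+ b :* b) :- (a :* a :- b :* b)) ≃-refl a b ⟩
    ∥ μ ∥² ⊝ (a ⊗ a ⊝ b ⊗ b)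
      ≈⟨ ⊕-cong ∥μ∥²≃c² (⊖-cong re-μ²) ⟩
    c ⊗ c ⊝ (c ⊗ c ⊝ 0ʳ ⊗ 0ʳ)
      ≈⟨ solve 1 (λ c → c :* c :- (c :* c :- con 0ℚ :* con 0ℚ) := con (1ℚ ℚ.+ 1ℚ) :* con 0ℚ)
           ≃-refl c ⟩
    2ʳ ⊗ 0ʳ ∎)))

module _ {n : ℕ} (G : Graph n) where
  open Graph G

  vertex : Connected → Fin n
  vertex (n≢0 , _) = go n n≢0
    where
    go : ∀ n → ℕ.NonZero n → Fin n
    go (suc _) _ = zero

  degree≤maxDegree : ∀ s → degree s ℕ.≤ maxDegree
  degree≤maxDegree s = All.lookup (xs≤max 0 (map degree (allFin n)))
    (∈-map⁺ degree (∈-allFin s))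

  ~⇒0<maxDegree : ∀ {s t} → s ~ t → 0 ℕ.< maxDegree
  ~⇒0<maxDegree {s} {t} s~t = ℕ.≤-trans
    (∈-length (∈-filter⁺ (s ~?_) (∈-allFin t) s~t)) (degree≤maxDegree s)

-- The bound on eigenvalues

module Spectral {n : ℕ} {G : Graph n} (Φ : GainGraph G) where
  open Graph G
  open GainGraph Φ hiding (A)
  open GainGraph using (A)
  open Gain Φ using (φφ⁻¹≋1)

  ∥φ∥²≃1 : ∀ s t (e : s ~ t) → ∥ φ s t e ∥² ≃ 1ʳ
  ∥φ∥²≃1 s t e = begin
    ∥ φ s t e ∥²                        ≈⟨ ∣z∣²≃∥z∥² (φ s t e) ⟨
    ∣ φ s t e ∣ᶜ ⊗ ∣ φ s t e ∣ᶜ         ≈⟨ ℝᵣ.*-cong ∣φ∣≃1 ∣φ∣≃1 ⟩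
    1ʳ ⊗ 1ʳ                             ≈⟨ ⊗-identityˡ 1ʳ ⟩
    1ʳ                                  ∎
    where
    open import Relation.Binary.Reasoning.Setoid ℝ-setoid
    ∣φ∣≃1 : ∣ φ s t e ∣ᶜ ≃ 1ʳ
    ∣φ∣≃1 = ≡.subst (∣ φ s t e ∣ᶜ ≃_) (fromℚ≡ι 1ℚ) (mk (unit s t e))

  adjacent : Fin n → Fin n → ℝ
  adjacent s t = indicator (s ~? t)

  degree≃∑ : ∀ s → ι (fromℕ (degree s)) ≃ ℝ∑.sum (adjacent s)
  degree≃∑ s = length-filter≃∑ (s ~?_) λ i → i

  -- `A` and `adjacent` branch on the same `s ~? t`. Recording each case by equations allows both to
  -- be substituted inside larger expressions.
  entry : ∀ s t → (Σ[ e ∈ s ~ t ] A Φ s t ≡ φ s t e × adjacent s t ≡ 1ʳ)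
                ⊎ (A Φ s t ≡ cx 0ʳ × adjacent s t ≡ 0ʳ)
  entry s t with s ~? t
  ... | yes e = inj₁ (e , ≡.refl , ≡.refl)
  ... | no  _ = inj₂ (0ᶜ≡cx0 , ≡.refl)

  edge : ∀ {s t} (e : s ~ t) → A Φ s t ≡ φ s t e × adjacent s t ≡ 1ʳ
  edge {s} {t} e with s ~? t
  ... | yes _   = ≡.refl , ≡.refl
  ... | no  s≁t = ⊥-elim (s≁t e)

  Δʳ : ℝ
  Δʳ = ι (fromℕ maxDegree)

  module Eigenvector (μ : ℂ) (v : Vector ℂ n)
    (Av≋μv : ∀ s → ℂ∑.sum (λ t → A Φ s t ⊠ v t) ≋ μ ⊠ v s) where

    -- For ∥ v s ∥² maximal, these nonnegative quantities have a sum over t in which the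
    -- ∥ v t ∥² cancel: this replaces the Cauchy–Schwarz inequality and its equality case.
    defect : ℝ → Fin n → Fin n → ℝ
    defect c s t = ∥ cx c ⊠ (A Φ s t ⊠ v t) ⊞ ⊟ (μ ⊠ v s) ∥²
                   ⊕ c ⊗ c ⊗ (∥ v s ∥² ⊝ ∥ v t ∥²)

    -- On an edge, `∥ φ s t e ∥² ≃ 1ʳ` makes the `∥ v t ∥²` cancel. The cross term carries no factor
    -- `adjacent s t`, because `A Φ s t` is 0 off the edges.
    defect≃ : ∀ c s t → adjacent s t ⊗ defect c s t ≃
      adjacent s t ⊗ (c ⊗ c ⊗ ∥ v s ∥² ⊕ ∥ μ ⊠ v s ∥²)
      ⊕ ⊖ (2ʳ ⊗ c) ⊗ re ((A Φ s t ⊠ v t) ⊠ conj (μ ⊠ v s))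
    defect≃ c s t with entry s t
    ... | inj₁ (e , A≡φ , adj≡1) = ≡.subst₂
      (λ a x → x ⊗ (∥ cx c ⊠ (a ⊠ v t) ⊞ ⊟ (μ ⊠ v s) ∥² ⊕ c ⊗ c ⊗ (∥ v s ∥² ⊝ ∥ v t ∥²)) ≃
        x ⊗ (c ⊗ c ⊗ ∥ v s ∥² ⊕ ∥ μ ⊠ v s ∥²) ⊕ ⊖ (2ʳ ⊗ c) ⊗ re ((a ⊠ v t) ⊠ conj (μ ⊠ v s)))
      (≡.sym A≡φ) (≡.sym adj≡1) (begin
        1ʳ ⊗ (∥ cx c ⊠ w ⊞ ⊟ u ∥² ⊕ c ⊗ c ⊗ (∥ v s ∥² ⊝ ∥ v t ∥²))
          ≈⟨ ⊗-congˡ (⊕-cong (≃-trans (∥cw-u∥² c w u) (⊕-cong (⊕-cong (⊗-congˡ ∥w∥²≃) ≃-refl)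
               ≃-refl)) ≃-refl) ⟩
        1ʳ ⊗ (c ⊗ c ⊗ ∥ v t ∥² ⊕ ∥ u ∥² ⊕ ⊖ (2ʳ ⊗ c) ⊗ re (w ⊠ conj u)
              ⊕ c ⊗ c ⊗ (∥ v s ∥² ⊝ ∥ v t ∥²))
          ≈⟨ solve 5 (λ k x y z r → con 1ℚ :* (k :* x :+ y :+ r :+ k :* (z :- x)) :=
               con 1ℚ :* (k :* z :+ y) :+ r) ≃-refl
               (c ⊗ c) ∥ v t ∥² ∥ u ∥² ∥ v s ∥² (⊖ (2ʳ ⊗ c) ⊗ re (w ⊠ conj u)) ⟩
        1ʳ ⊗ (c ⊗ c ⊗ ∥ v s ∥² ⊕ ∥ u ∥²) ⊕ ⊖ (2ʳ ⊗ c) ⊗ re (w ⊠ conj u) ∎)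
      where
      open import Relation.Binary.Reasoning.Setoid ℝ-setoid
      w = φ s t e ⊠ v t
      u = μ ⊠ v s
      ∥w∥²≃ : ∥ w ∥² ≃ ∥ v t ∥²
      ∥w∥²≃ = ≃-trans (∥∥²-⊠ (φ s t e) (v t))
        (≃-trans (⊗-cong (∥φ∥²≃1 s t e) ≃-refl) (⊗-identityˡ ∥ v t ∥²))
    ... | inj₂ (A≡0 , adj≡0) = ≡.subst₂
      (λ a x → x ⊗ (∥ cx c ⊠ (a ⊠ v t) ⊞ ⊟ (μ ⊠ v s) ∥² ⊕ c ⊗ c ⊗ (∥ v s ∥² ⊝ ∥ v t ∥²)) ≃
        x ⊗ (c ⊗ c ⊗ ∥ v s ∥² ⊕ ∥ μ ⊠ v s ∥²) ⊕ ⊖ (2ʳ ⊗ c) ⊗ re ((a ⊠ v t) ⊠ conj (μ ⊠ v s)))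
      (≡.sym A≡0) (≡.sym adj≡0)
      (solve 7 (λ x y k p q d e → con 0ℚ :* x := con 0ℚ :* y :+ k :*
          ((con 0ℚ :* p :- con 0ℚ :* q) :* d :- (con 0ℚ :* q :+ con 0ℚ :* p) :* :- e)) ≃-refl
        (∥ cx c ⊠ (cx 0ʳ ⊠ v t) ⊞ ⊟ (μ ⊠ v s) ∥² ⊕ c ⊗ c ⊗ (∥ v s ∥² ⊝ ∥ v t ∥²))
        (c ⊗ c ⊗ ∥ v s ∥² ⊕ ∥ μ ⊠ v s ∥²)
        (⊖ (2ʳ ⊗ c)) (re (v t)) (im (v t)) (re (μ ⊠ v s)) (im (μ ⊠ v s)))

    -- Here `Av≋μv` enters: the sum is the real part of `u ⊠ conj u` for `u = μ ⊠ v s`.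
    re-∑≃ : ∀ s → ℝ∑.sum (λ t → re ((A Φ s t ⊠ v t) ⊠ conj (μ ⊠ v s))) ≃ ∥ μ ⊠ v s ∥²
    re-∑≃ s = begin
      ℝ∑.sum (λ t → re ((A Φ s t ⊠ v t) ⊠ conj u))      ≈⟨ re-∑ (λ t → (A Φ s t ⊠ v t) ⊠ conj u) ⟨
      re (ℂ∑.sum (λ t → (A Φ s t ⊠ v t) ⊠ conj u))
        ≈⟨ _≋_.re-≃ (ℂ∑.*-distribʳ-sum (conj u) (λ t → A Φ s t ⊠ v t)) ⟨
      re (ℂ∑.sum (λ t → A Φ s t ⊠ v t) ⊠ conj u)        ≈⟨ _≋_.re-≃ (⊠-cong (Av≋μv s) ≋-refl) ⟩
      re (u ⊠ conj u)
        ≈⟨ solve 2 (λ d e → d :* d :- e :* :- e := d :* d :+ e :* e) ≃-refl (re u) (im u) ⟩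
      ∥ u ∥²                                          ∎
      where
      open import Relation.Binary.Reasoning.Setoid ℝ-setoid
      u = μ ⊠ v s

    ∑-defect : ∀ c s → let d = ι (fromℕ (degree s)) in
      ℝ∑.sum (λ t → adjacent s t ⊗ defect c s t) ≃
      (d ⊗ (c ⊗ c ⊕ ∥ μ ∥²) ⊝ 2ʳ ⊗ c ⊗ ∥ μ ∥²) ⊗ ∥ v s ∥²
    ∑-defect c s = begin
      ℝ∑.sum (λ t → adjacent s t ⊗ defect c s t)
        ≈⟨ ℝ∑.sum-cong-≋ (defect≃ c s) ⟩
      ℝ∑.sum (λ t → adjacent s t ⊗ K ⊕ k ⊗ r t)
        ≈⟨ ℝ∑.∑-distrib-+ (λ t → adjacent s t ⊗ K) (λ t → k ⊗ r t) ⟩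
      ℝ∑.sum (λ t → adjacent s t ⊗ K) ⊕ ℝ∑.sum (λ t → k ⊗ r t)
        ≈⟨ ⊕-cong (ℝ∑.*-distribʳ-sum K (adjacent s)) (ℝ∑.*-distribˡ-sum k r) ⟨
      ℝ∑.sum (adjacent s) ⊗ K ⊕ k ⊗ ℝ∑.sum r
        ≈⟨ ⊕-cong (⊗-cong (≃-sym (degree≃∑ s)) ≃-refl) (⊗-congˡ (re-∑≃ s)) ⟩
      d ⊗ (c ⊗ c ⊗ ∥ v s ∥² ⊕ ∥ μ ⊠ v s ∥²) ⊕ k ⊗ ∥ μ ⊠ v s ∥²
        ≈⟨ ⊕-cong (⊗-congˡ (⊕-cong ≃-refl (∥∥²-⊠ μ (v s)))) (⊗-congˡ (∥∥²-⊠ μ (v s))) ⟩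
      d ⊗ (c ⊗ c ⊗ ∥ v s ∥² ⊕ ∥ μ ∥² ⊗ ∥ v s ∥²) ⊕ k ⊗ (∥ μ ∥² ⊗ ∥ v s ∥²)
        ≈⟨ solve 4 (λ d c p m → d :* (c :* c :* m :+ p :* m) :+
             :- (con (1ℚ ℚ.+ 1ℚ) :* c) :* (p :* m) :=
             (d :* (c :* c :+ p) :- con (1ℚ ℚ.+ 1ℚ) :* c :* p) :* m) ≃-refl
             d c ∥ μ ∥² ∥ v s ∥² ⟩
      (d ⊗ (c ⊗ c ⊕ ∥ μ ∥²) ⊝ 2ʳ ⊗ c ⊗ ∥ μ ∥²) ⊗ ∥ v s ∥² ∎
      where
      open import Relation.Binary.Reasoning.Setoid ℝ-setoid
      d = ι (fromℕ (degree s))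
      k = ⊖ (2ʳ ⊗ c)
      K = c ⊗ c ⊗ ∥ v s ∥² ⊕ ∥ μ ⊠ v s ∥²
      r : Fin n → ℝ
      r t = re ((A Φ s t ⊠ v t) ⊠ conj (μ ⊠ v s))

    Maximal : Fin n → Set
    Maximal s = ∀ t → ∥ v t ∥² ⊑ ∥ v s ∥²

    defect-nonNeg : ∀ c {s} → Maximal s → ∀ t → 0ʳ ⊑ adjacent s t ⊗ defect c s t
    defect-nonNeg c {s} max t = ⊗-nonNeg adj-nonNeg
      (⊑-trans (≃⇒⊒ (⊕-identityˡ 0ʳ)) (⊕-mono-⊑ (∥∥²-nonNeg _)
        (⊗-nonNeg (0⊑x⊗x c) (x⊑y⇒0⊑y⊝x (max t)))))
      where
      adj-nonNeg : 0ʳ ⊑ adjacent s t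
      adj-nonNeg with s ~? t
      ... | yes _ = ι-mono-⊑ (ℚ.nonNegative⁻¹ 1ℚ)
      ... | no  _ = ⊑-refl

    ∑-defect-nonNeg : ∀ c {s} → Maximal s → ¬ ∥ v s ∥² ⊑ 0ʳ →
      0ʳ ⊑ ι (fromℕ (degree s)) ⊗ (c ⊗ c ⊕ ∥ μ ∥²) ⊝ 2ʳ ⊗ c ⊗ ∥ μ ∥²
    ∑-defect-nonNeg c {s} max m⋢0 = ⊗-cancelˡ-⊑ m⋢0 (begin
      ∥ v s ∥² ⊗ 0ʳ
        ≈⟨ ℝᵣ.zeroʳ ∥ v s ∥² ⟩
      0ʳ
        ≤⟨ ∑-nonNeg (defect-nonNeg c max) ⟩
      ℝ∑.sum (λ t → adjacent s t ⊗ defect c s t)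
        ≈⟨ ∑-defect c s ⟩
      (ι (fromℕ (degree s)) ⊗ (c ⊗ c ⊕ ∥ μ ∥²) ⊝ 2ʳ ⊗ c ⊗ ∥ μ ∥²) ⊗ ∥ v s ∥²
        ≈⟨ ⊗-comm _ ∥ v s ∥² ⟩
      ∥ v s ∥² ⊗ (ι (fromℕ (degree s)) ⊗ (c ⊗ c ⊕ ∥ μ ∥²) ⊝ 2ʳ ⊗ c ⊗ ∥ μ ∥²) ∎)
      where open ⊑-Reasoning

    -- `P` in the name is `∥ μ ∥²`. The degree in `∑-defect-nonNeg` has a nonnegative coefficient,
    -- so it may be raised to Δ.
    2cP⊑Δ[c²+P] : ∀ c {s} → Maximal s → ¬ ∥ v s ∥² ⊑ 0ʳ →
      2ʳ ⊗ c ⊗ ∥ μ ∥² ⊑ Δʳ ⊗ (c ⊗ c ⊕ ∥ μ ∥²)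
    2cP⊑Δ[c²+P] c {s} max m⋢0 = begin
      2ʳ ⊗ c ⊗ ∥ μ ∥²                               ≈⟨ ⊕-identityˡ _ ⟨
      0ʳ ⊕ 2ʳ ⊗ c ⊗ ∥ μ ∥²                          ≤⟨ ⊕-mono-⊑ (∑-defect-nonNeg c max m⋢0) ⊑-refl ⟩
      d ⊗ (c ⊗ c ⊕ ∥ μ ∥²) ⊝ 2ʳ ⊗ c ⊗ ∥ μ ∥² ⊕ 2ʳ ⊗ c ⊗ ∥ μ ∥²
        ≈⟨ solve 2 (λ x y → x :- y :+ y := x) ≃-refl (d ⊗ (c ⊗ c ⊕ ∥ μ ∥²)) (2ʳ ⊗ c ⊗ ∥ μ ∥²) ⟩
      d ⊗ (c ⊗ c ⊕ ∥ μ ∥²)                          ≈⟨ ⊗-comm d _ ⟩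
      (c ⊗ c ⊕ ∥ μ ∥²) ⊗ d
        ≤⟨ ⊗-monoˡ-⊑ (⊑-trans (≃⇒⊒ (⊕-identityˡ 0ʳ)) (⊕-mono-⊑ (0⊑x⊗x c) (∥∥²-nonNeg μ)))
             (ι-mono-⊑ (fromℕ-mono-≤ (degree≤maxDegree G s))) ⟩
      (c ⊗ c ⊕ ∥ μ ∥²) ⊗ Δʳ                         ≈⟨ ⊗-comm _ Δʳ ⟩
      Δʳ ⊗ (c ⊗ c ⊕ ∥ μ ∥²)                         ∎
      where
      open ⊑-Reasoning
      d = ι (fromℕ (degree s))

    ∥μ∥²⊑Δ² : ∀ {s} → Maximal s → ¬ ∥ v s ∥² ⊑ 0ʳ → ∥ μ ∥² ⊑ Δʳ ⊗ Δʳ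
    ∥μ∥²⊑Δ² {s} max m⋢0 = go maxDegree ≡.refl
      where
      open ⊑-Reasoning
      go : ∀ k → maxDegree ≡ k → ∥ μ ∥² ⊑ Δʳ ⊗ Δʳ
      -- For Δ = 0 the choice `c = Δ` gives no information; `c = 1` gives `2 ∥ μ ∥² ≤ 0`.
      go zero Δ≡0 = ⊗-cancelˡ-⊑ 2ʳ⋢0 (begin
        2ʳ ⊗ ∥ μ ∥²                   ≈⟨ ⊗-cong (ℝᵣ.*-identityʳ 2ʳ) ≃-refl ⟨
        2ʳ ⊗ 1ʳ ⊗ ∥ μ ∥²              ≤⟨ 2cP⊑Δ[c²+P] 1ʳ max m⋢0 ⟩
        Δʳ ⊗ (1ʳ ⊗ 1ʳ ⊕ ∥ μ ∥²)       ≡⟨ ≡.cong (λ k → ι (fromℕ k) ⊗ (1ʳ ⊗ 1ʳ ⊕ ∥ μ ∥²)) Δ≡0 ⟩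
        0ʳ ⊗ (1ʳ ⊗ 1ʳ ⊕ ∥ μ ∥²)       ≈⟨ solve 1 (λ x → con 0ℚ :* x :=
                                           con (1ℚ ℚ.+ 1ℚ) :* (con 0ℚ :* con 0ℚ)) ≃-refl _ ⟩
        2ʳ ⊗ (0ʳ ⊗ 0ʳ)                ≡⟨ ≡.cong (λ k → 2ʳ ⊗ (ι (fromℕ k) ⊗ ι (fromℕ k))) Δ≡0 ⟨
        2ʳ ⊗ (Δʳ ⊗ Δʳ)                ∎)
      -- `c = Δ` gives `2 Δ ∥ μ ∥² ≤ Δ (Δ² + ∥ μ ∥²)`; after subtracting `Δ ∥ μ ∥²`, the positive
      -- factor Δ cancels.
      go (suc k) Δ≡1+k = ⊗-cancelˡ-⊑
        (≡.subst (λ k → ¬ ι (fromℕ k) ⊑ 0ʳ) (≡.sym Δ≡1+k) (0<p⇒ιp⋢0 (fromℕ-suc-pos k))) (begin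
        Δʳ ⊗ ∥ μ ∥²
          ≈⟨ solve 2 (λ c p → c :* p := con (1ℚ ℚ.+ 1ℚ) :* c :* p :- c :* p) ≃-refl Δʳ ∥ μ ∥² ⟩
        2ʳ ⊗ Δʳ ⊗ ∥ μ ∥² ⊝ Δʳ ⊗ ∥ μ ∥²
          ≤⟨ ⊕-mono-⊑ (2cP⊑Δ[c²+P] Δʳ max m⋢0) ⊑-refl ⟩
        Δʳ ⊗ (Δʳ ⊗ Δʳ ⊕ ∥ μ ∥²) ⊝ Δʳ ⊗ ∥ μ ∥²
          ≈⟨ solve 2 (λ c p → c :* (c :* c :+ p) :- c :* p := c :* (c :* c)) ≃-refl Δʳ ∥ μ ∥² ⟩
        Δʳ ⊗ (Δʳ ⊗ Δʳ) ∎)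

    -- If the largest `∥ v s ∥²` vanished, `v` would be 0.
    ¬¬extremal : Fin n → ¬ (∀ s → v s ≋ cx 0ʳ) →
                 ¬ ¬ (∃[ s ] Maximal s × ¬ ∥ v s ∥² ⊑ 0ʳ)
    ¬¬extremal base v≢0 k = ¬¬maximum (λ s → ∥ v s ∥²) base λ (s , max) →
      k (s , max , λ m⊑0 → v≢0 λ t → ∥z∥²⊑0⇒z≋0 (⊑-trans (max t) m⊑0))

    ∣μ∣⊑Δ : Fin n → ¬ (∀ s → v s ≋ cx 0ʳ) → ∣ μ ∣ᶜ ⊑ Δʳ
    ∣μ∣⊑Δ base v≢0 = ⊑-stable λ k → ¬¬extremal base v≢0 λ (s , max , m⋢0) →
      k (square-cancel-⊑ (ι-mono-⊑ (fromℕ-nonNeg maxDegree))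
          (⊑-trans (≃⇒⊑ (∣z∣²≃∥z∥² μ)) (∥μ∥²⊑Δ² max m⋢0)))

    -- The equality case

    module Extremal (Δ⋢0 : ¬ Δʳ ⊑ 0ʳ) (∥μ∥²≃Δ² : ∥ μ ∥² ≃ Δʳ ⊗ Δʳ) where

      -- The factor in `∑-defect` for `c = Δ` and `∥ μ ∥² = Δ²`. Its nonnegativity forces `d ≥ Δ`,
      -- and it vanishes for `d = Δ`.
      d[c²+P]-2cP≃ : ∀ d → d ⊗ (Δʳ ⊗ Δʳ ⊕ ∥ μ ∥²) ⊝ 2ʳ ⊗ Δʳ ⊗ ∥ μ ∥² ≃
                           2ʳ ⊗ (Δʳ ⊗ Δʳ) ⊗ (d ⊝ Δʳ)
      d[c²+P]-2cP≃ d = begin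
        d ⊗ (Δʳ ⊗ Δʳ ⊕ ∥ μ ∥²) ⊝ 2ʳ ⊗ Δʳ ⊗ ∥ μ ∥²
          ≈⟨ ⊕-cong (⊗-congˡ (⊕-cong ≃-refl ∥μ∥²≃Δ²)) (⊖-cong (⊗-congˡ ∥μ∥²≃Δ²)) ⟩
        d ⊗ (Δʳ ⊗ Δʳ ⊕ Δʳ ⊗ Δʳ) ⊝ 2ʳ ⊗ Δʳ ⊗ (Δʳ ⊗ Δʳ)
          ≈⟨ solve 2 (λ d c → d :* (c :* c :+ c :* c) :- con (1ℚ ℚ.+ 1ℚ) :* c :* (c :* c) :=
               con (1ℚ ℚ.+ 1ℚ) :* (c :* c) :* (d :- c)) ≃-refl d Δʳ ⟩
        2ʳ ⊗ (Δʳ ⊗ Δʳ) ⊗ (d ⊝ Δʳ) ∎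
        where open import Relation.Binary.Reasoning.Setoid ℝ-setoid

      degree≡Δ : ∀ {s} → Maximal s → ¬ ∥ v s ∥² ⊑ 0ʳ → degree s ≡ maxDegree
      degree≡Δ {s} max m⋢0 = ℕ.≤-antisym (degree≤maxDegree G s) (fromℕ-cancel-≤ (ι-cancel-⊑ (begin
        Δʳ              ≈⟨ ⊕-identityˡ Δʳ ⟨
        0ʳ ⊕ Δʳ         ≤⟨ ⊕-mono-⊑ 0⊑d-Δ ⊑-refl ⟩
        d ⊝ Δʳ ⊕ Δʳ     ≈⟨ solve 2 (λ d c → d :- c :+ c := d) ≃-refl d Δʳ ⟩
        d               ∎)))
        where
        open ⊑-Reasoning
        d = ι (fromℕ (degree s))
        0⊑d-Δ : 0ʳ ⊑ d ⊝ Δʳ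
        0⊑d-Δ = ⊗-cancelˡ-⊑ (⊗-pos 2ʳ⋢0 (⊗-pos Δ⋢0 Δ⋢0)) (begin
          2ʳ ⊗ (Δʳ ⊗ Δʳ) ⊗ 0ʳ                              ≈⟨ ℝᵣ.zeroʳ _ ⟩
          0ʳ                                               ≤⟨ ∑-defect-nonNeg Δʳ max m⋢0 ⟩
          d ⊗ (Δʳ ⊗ Δʳ ⊕ ∥ μ ∥²) ⊝ 2ʳ ⊗ Δʳ ⊗ ∥ μ ∥²        ≈⟨ d[c²+P]-2cP≃ d ⟩
          2ʳ ⊗ (Δʳ ⊗ Δʳ) ⊗ (d ⊝ Δʳ)                        ∎)

      -- As the degree of `s` is Δ, the nonnegative defects over its neighbours sum to 0.
      defect⊑0 : ∀ {s t} → Maximal s → ¬ ∥ v s ∥² ⊑ 0ʳ → s ~ t → defect Δʳ s t ⊑ 0ʳ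
      defect⊑0 {s} {t} max m⋢0 e = begin
        defect Δʳ s t                     ≈⟨ ⊗-identityˡ _ ⟨
        1ʳ ⊗ defect Δʳ s t                ≡⟨ ≡.cong (_⊗ defect Δʳ s t) (proj₂ (edge e)) ⟨
        adjacent s t ⊗ defect Δʳ s t      ≤⟨ ∑⊑0⇒⊑0 (defect-nonNeg Δʳ max) ∑⊑0 t ⟩
        0ʳ                                ∎
        where
        open ⊑-Reasoning
        ∑⊑0 : ℝ∑.sum (λ t → adjacent s t ⊗ defect Δʳ s t) ⊑ 0ʳ
        ∑⊑0 = begin
          ℝ∑.sum (λ t → adjacent s t ⊗ defect Δʳ s t)
            ≈⟨ ∑-defect Δʳ s ⟩
          (ι (fromℕ (degree s)) ⊗ (Δʳ ⊗ Δʳ ⊕ ∥ μ ∥²) ⊝ 2ʳ ⊗ Δʳ ⊗ ∥ μ ∥²) ⊗ ∥ v s ∥²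
            ≡⟨ ≡.cong (λ k → (ι (fromℕ k) ⊗ (Δʳ ⊗ Δʳ ⊕ ∥ μ ∥²) ⊝ 2ʳ ⊗ Δʳ ⊗ ∥ μ ∥²) ⊗ ∥ v s ∥²)
                 (degree≡Δ max m⋢0) ⟩
          (Δʳ ⊗ (Δʳ ⊗ Δʳ ⊕ ∥ μ ∥²) ⊝ 2ʳ ⊗ Δʳ ⊗ ∥ μ ∥²) ⊗ ∥ v s ∥²
            ≈⟨ ⊗-cong (d[c²+P]-2cP≃ Δʳ) ≃-refl ⟩
          2ʳ ⊗ (Δʳ ⊗ Δʳ) ⊗ (Δʳ ⊝ Δʳ) ⊗ ∥ v s ∥²
            ≈⟨ solve 2 (λ c m → con (1ℚ ℚ.+ 1ℚ) :* (c :* c) :* (c :- c) :* m := con 0ℚ) ≃-refl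
                 Δʳ ∥ v s ∥² ⟩
          0ʳ ∎

      -- Both summands of the defect are nonnegative, so each vanishes: the second gives the
      -- inequality, the first the equation.
      neighbour : ∀ {s t} → Maximal s → ¬ ∥ v s ∥² ⊑ 0ʳ → (e : s ~ t) →
                  ∥ v s ∥² ⊑ ∥ v t ∥² × cx Δʳ ⊠ (φ s t e ⊠ v t) ≋ μ ⊠ v s
      neighbour {s} {t} max m⋢0 e =
          ⊝⊑0⇒⊑ (⊗-cancelˡ-⊑ (⊗-pos Δ⋢0 Δ⋢0)
            (⊑-trans (x⊕y⊑0⇒y⊑0 (∥∥²-nonNeg _) (defect⊑0 max m⋢0 e)) (≃⇒⊒ (ℝᵣ.zeroʳ _))))
        , z⊟w≋0⇒z≋w (∥z∥²⊑0⇒z≋0 (≡.subst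
            (λ a → ∥ cx Δʳ ⊠ (a ⊠ v t) ⊞ ⊟ (μ ⊠ v s) ∥² ⊑ 0ʳ) (proj₁ (edge e))
            (x⊕y⊑0⇒x⊑0 (⊗-nonNeg (0⊑x⊗x Δʳ) (x⊑y⇒0⊑y⊝x (max t))) (defect⊑0 max m⋢0 e))))

      spread : ∀ {s t} → Walk s t → Maximal s → ¬ ∥ v s ∥² ⊑ 0ʳ → Maximal t × ¬ ∥ v t ∥² ⊑ 0ʳ
      spread ε       max m⋢0 = max , m⋢0
      spread (e ◅ w) max m⋢0 = let s⊑t = proj₁ (neighbour max m⋢0 e) in
        spread w (λ r → ⊑-trans (max r) s⊑t) (λ t⊑0 → m⋢0 (⊑-trans s⊑t t⊑0))

      ¬¬extremal-everywhere : Connected → ¬ (∀ s → v s ≋ cx 0ʳ) →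
                              ¬ ¬ (∀ s → Maximal s × ¬ ∥ v s ∥² ⊑ 0ʳ)
      ¬¬extremal-everywhere connected@(_ , walk) v≢0 k =
        ¬¬extremal (vertex G connected) v≢0 λ (s , max , m⋢0) → k λ t → spread (walk s t) max m⋢0

      module Everywhere (extremal : ∀ s → Maximal s × ¬ ∥ v s ∥² ⊑ 0ʳ) where

        Δφv≋μv : ∀ {s t} (e : s ~ t) → cx Δʳ ⊠ (φ s t e ⊠ v t) ≋ μ ⊠ v s
        Δφv≋μv {s} e = proj₂ (neighbour (proj₁ (extremal s)) (proj₂ (extremal s)) e)

        -- Traversing the edge in both directions, `μ² v_s = Δ φ_st (μ v_t) = Δ² φ_st φ_ts v_s`, and
        -- the two gains are inverse.
        μ²≋Δ² : ∀ {s t} → s ~ t → μ ⊠ μ ≋ cx Δʳ ⊠ cx Δʳ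
        μ²≋Δ² {s} {t} e = ⊠-cancelʳ (proj₂ (extremal s)) (begin
          μ ⊠ μ ⊠ v s
            ≈⟨ ℂᵣ.*-assoc μ μ (v s) ⟩
          μ ⊠ (μ ⊠ v s)
            ≈⟨ ⊠-cong ≋-refl (Δφv≋μv e) ⟨
          μ ⊠ (cx Δʳ ⊠ (φ s t e ⊠ v t))
            ≈⟨ ℂ*.solve 4 (λ a b c d → a ⊛ (b ⊛ (c ⊛ d)) ⊜ b ⊛ (c ⊛ (a ⊛ d))) ≋-refl
                 μ (cx Δʳ) (φ s t e) (v t) ⟩
          cx Δʳ ⊠ (φ s t e ⊠ (μ ⊠ v t))
            ≈⟨ ⊠-cong ≋-refl (⊠-cong ≋-refl (Δφv≋μv (~-sym e))) ⟨
          cx Δʳ ⊠ (φ s t e ⊠ (cx Δʳ ⊠ (φ t s (~-sym e) ⊠ v s)))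
            ≈⟨ ℂ*.solve 4 (λ a b c d → a ⊛ (b ⊛ (a ⊛ (c ⊛ d))) ⊜ (a ⊛ a) ⊛ ((c ⊛ b) ⊛ d)) ≋-refl
                 (cx Δʳ) (φ s t e) (φ t s (~-sym e)) (v s) ⟩
          cx Δʳ ⊠ cx Δʳ ⊠ (φ t s (~-sym e) ⊠ φ s t e ⊠ v s)
            ≈⟨ ⊠-cong ≋-refl (⊠-cong (φφ⁻¹≋1 e (~-sym e)) ≋-refl) ⟩
          cx Δʳ ⊠ cx Δʳ ⊠ (cx 1ʳ ⊠ v s)
            ≈⟨ ⊠-cong ≋-refl (ℂᵣ.*-identityˡ (v s)) ⟩
          cx Δʳ ⊠ cx Δʳ ⊠ v s ∎)
          where open ≋-Reasoning

        cancel-Δ : ∀ {z w} → cx Δʳ ⊠ z ≋ cx Δʳ ⊠ w → z ≋ w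
        cancel-Δ {z} {w} h = ⊠-cancelʳ (λ ∥Δ∥²⊑0 → ⊗-pos Δ⋢0 Δ⋢0 (⊑-trans (≃⇒⊑ (solve 1
            (λ c → c :* c := c :* c :+ con 0ℚ :* con 0ℚ) ≃-refl Δʳ)) ∥Δ∥²⊑0))
          (≋-trans (ℂᵣ.*-comm z (cx Δʳ)) (≋-trans h (ℂᵣ.*-comm (cx Δʳ) w)))

        -- Positivity of `Δʳ ⊕ re μ` rules out `μ = −Δ`; the edge `e` itself supplies `μ²≋Δ²`.
        harmonic : ¬ Δʳ ⊕ re μ ⊑ 0ʳ → Gain.Harmonic Φ v
        harmonic Δ+μ⋢0 {s} {t} e = cancel-Δ (≋-trans (Δφv≋μv e)
          (⊠-cong (∥μ∥²≃c²∧μ²≋c²⇒μ≋c ∥μ∥²≃Δ² (μ²≋Δ² e) Δ+μ⋢0) ≋-refl))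

        -- The same argument for `⊟ μ`, whose square is also Δ².
        -harmonic : ¬ Δʳ ⊝ re μ ⊑ 0ʳ → Gain.Harmonic (-ᵍ Φ) v
        -harmonic Δ-μ⋢0 {s} {t} e = ≡.subst (λ a → a ⊠ v t ≋ v s) (≡.sym (-ᶜ≡⊟ (φ s t e)))
          (cancel-Δ (begin
            cx Δʳ ⊠ (⊟ φ s t e ⊠ v t)       ≈⟨ ⊠-cong ≋-refl (-‿distribˡ-* (φ s t e) (v t)) ⟨
            cx Δʳ ⊠ ⊟ (φ s t e ⊠ v t)       ≈⟨ -‿distribʳ-* (cx Δʳ) (φ s t e ⊠ v t) ⟨
            ⊟ (cx Δʳ ⊠ (φ s t e ⊠ v t))     ≈⟨ ⊟-cong (Δφv≋μv e) ⟩
            ⊟ (μ ⊠ v s)                     ≈⟨ -‿distribˡ-* μ (v s) ⟩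
            ⊟ μ ⊠ v s                       ≈⟨ ⊠-cong (∥μ∥²≃c²∧μ²≋c²⇒μ≋c
              (≃-trans (∥∥²-⊟ μ) ∥μ∥²≃Δ²) (≋-trans -μ-μ≋μμ (μ²≋Δ² e)) Δ-μ⋢0) ≋-refl ⟩
            cx Δʳ ⊠ v s                     ∎))
          where
          open ≋-Reasoning
          open import Algebra.Properties.Ring ℂᵣ.ring using (-‿distribˡ-*; -‿distribʳ-*)
          -μ-μ≋μμ : ⊟ μ ⊠ ⊟ μ ≋ μ ⊠ μ
          -μ-μ≋μμ = mk
            (solve 2 (λ a b → :- a :* :- a :- :- b :* :- b := a :* a :- b :* b) ≃-refl (re μ) (im μ))
            (solve 2 (λ a b → :- a :* :- b :+ :- b :* :- a := a :* b :+ b :* a) ≃-refl (re μ) (im μ))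

  -- The terms at the neighbours of `s` all equal `κ ⊠ v s`. The scalar `κ` will be 1 or -1,
  -- according to whether `Φ` or `-ᵍ Φ` is balanced.
  regular⇒eigen : ∀ κ (v : Vector ℂ n) → (∀ {s t} (e : s ~ t) → φ s t e ⊠ v t ≋ κ ⊠ v s) →
    ∀ {s} → degree s ≡ maxDegree → ℂ∑.sum (λ t → A Φ s t ⊠ v t) ≋ cx Δʳ ⊠ κ ⊠ v s
  regular⇒eigen κ v φv≋κv {s} d≡Δ = begin
    ℂ∑.sum (λ t → A Φ s t ⊠ v t)                        ≈⟨ ℂ∑.sum-cong-≋ term ⟩
    ℂ∑.sum (λ t → cx (adjacent s t) ⊠ (κ ⊠ v s))      ≈⟨ ℂ∑.*-distribʳ-sum (κ ⊠ v s) (λ t → cx (adjacent s t)) ⟨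
    ℂ∑.sum (λ t → cx (adjacent s t)) ⊠ (κ ⊠ v s)      ≈⟨ ⊠-cong (cx-∑ (adjacent s)) ≋-refl ⟩
    cx (ℝ∑.sum (adjacent s)) ⊠ (κ ⊠ v s)              ≈⟨ ⊠-cong (mk (degree≃∑ s) ≃-refl) ≋-refl ⟨
    cx (ι (fromℕ (degree s))) ⊠ (κ ⊠ v s)             ≡⟨ ≡.cong (λ d → cx (ι (fromℕ d)) ⊠ (κ ⊠ v s)) d≡Δ ⟩
    cx Δʳ ⊠ (κ ⊠ v s)                                 ≈⟨ ℂᵣ.*-assoc (cx Δʳ) κ (v s) ⟨
    cx Δʳ ⊠ κ ⊠ v s                                   ∎
    where
    open ≋-Reasoning
    term : ∀ t → A Φ s t ⊠ v t ≋ cx (adjacent s t) ⊠ (κ ⊠ v s)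
    term t with entry s t
    ... | inj₁ (e , A≡φ , adj≡1) = ≡.subst₂ (λ a x → a ⊠ v t ≋ cx x ⊠ (κ ⊠ v s))
            (≡.sym A≡φ) (≡.sym adj≡1) (≋-trans (φv≋κv e) (≋-sym (ℂᵣ.*-identityˡ (κ ⊠ v s))))
    ... | inj₂ (A≡0 , adj≡0) = ≡.subst₂ (λ a x → a ⊠ v t ≋ cx x ⊠ (κ ⊠ v s))
            (≡.sym A≡0) (≡.sym adj≡0) (≋-trans (ℂᵣ.zeroˡ (v t)) (≋-sym (ℂᵣ.zeroˡ (κ ⊠ v s))))

-- Return to the original definitions

∑-eigen : ∀ {n} (M : Matrix n) μ v → (∀ s → (M ·ᵥ v) s ≈ᶜ μ *ᶜ v s) →
          ∀ s → ℂ∑.sum (λ t → M s t ⊠ v t) ≋ μ ⊠ v s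
∑-eigen M μ v Mv≈μv s =
  ≡.subst₂ _≋_ (·ᵥ≡∑ M v s) (*ᶜ≡⊠ μ (v s)) (≈ᶜ⇒≋ {(M ·ᵥ v) s} {μ *ᶜ v s} (Mv≈μv s))

∑-eigen⁻¹ : ∀ {n} (M : Matrix n) μ v → (∀ s → ℂ∑.sum (λ t → M s t ⊠ v t) ≋ μ ⊠ v s) →
            ∀ s → (M ·ᵥ v) s ≈ᶜ μ *ᶜ v s
∑-eigen⁻¹ M μ v Mv≋μv s =
  ≋⇒≈ᶜ {(M ·ᵥ v) s} {μ *ᶜ v s}
    (≡.subst₂ _≋_ (≡.sym (·ᵥ≡∑ M v s)) (≡.sym (*ᶜ≡⊠ μ (v s))) (Mv≋μv s))

v≢0⇒¬v≋0 : ∀ {n} (v : Vector ℂ n) → ¬ (∀ s → v s ≈ᶜ 0ᶜ) → ¬ (∀ s → v s ≋ cx 0ʳ)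
v≢0⇒¬v≋0 v v≢0 v≋0 = v≢0 λ s →
  ≋⇒≈ᶜ {v s} {0ᶜ} (≡.subst (v s ≋_) (≡.sym 0ᶜ≡cx0) (v≋0 s))

-- Balance consists of equations between complex numbers, which are ¬¬-stable; it may thus be proved
-- from vertices of maximal norm that exist only under a double negation.
Balanced-stable : ∀ {n} {G : Graph n} (Φ : GainGraph G) →
                  ¬ ¬ GainGraph.Balanced Φ → GainGraph.Balanced Φ
Balanced-stable Φ h C = ≋⇒≈ᶜ {g} {1ᶜ} (≋-stable λ k → h λ balanced → k (≈ᶜ⇒≋ {g} {1ᶜ} (balanced C)))
  where g = GainGraph.gain Φ (Graph.DirectedCycle.walk C)

-- The two implications

module _ {n : ℕ} {G : Graph n} (Φ : GainGraph G) (connected : Graph.Connected G) where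
  open Graph G
  open GainGraph Φ hiding (A)
  open GainGraph using (A)
  open Spectral Φ

  acyclic⇒balanced : maxDegree ≡ 0 → Balanced
  acyclic⇒balanced Δ≡0 C with DirectedCycle.walk C | DirectedCycle.3≤length C
  ... | e ◅ _ | _ = ⊥-elim (ℕ.<-irrefl ≡.refl (≡.subst (0 ℕ.<_) Δ≡0 (~⇒0<maxDegree G e)))

  extremal⇒regular-balanced : ∀ μ → IsEigenvalue (A Φ) μ → ∣ μ ∣ᶜ ≃ Δʳ →
    Regular maxDegree × (Balanced ⊎ GainGraph.Balanced (-ᵍ Φ))
  extremal⇒regular-balanced μ (v , v≢0 , Av≈μv) ∣μ∣≃Δ = go maxDegree ≡.refl
    where
    open Eigenvector μ v (∑-eigen (A Φ) μ v Av≈μv)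

    go : ∀ k → maxDegree ≡ k → Regular maxDegree × (Balanced ⊎ GainGraph.Balanced (-ᵍ Φ))
    -- `Extremal` needs Δ > 0. For Δ = 0 all degrees are 0 and there are no cycles.
    go zero Δ≡0 = (λ s → ℕ.≤-antisym (degree≤maxDegree G s) (ℕ.≤-trans (ℕ.≤-reflexive Δ≡0) ℕ.z≤n))
                , inj₁ (acyclic⇒balanced Δ≡0)
    -- The threshold ½ lies below `1 ≤ Δ`: if `re μ` is at most ½, then `Δʳ ⊝ re μ` is positive, and
    -- if `re μ` is positive, then so is `Δʳ ⊕ re μ`.
    go (suc k) Δ≡1+k = regular , balanced (small⊎positive (re μ) ½ (ℚ.positive⁻¹ ½))
      where
      0<Δ : 0ℚ ℚ.< fromℕ maxDegree
      0<Δ = ≡.subst (λ k → 0ℚ ℚ.< fromℕ k) (≡.sym Δ≡1+k) (fromℕ-suc-pos k)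

      1≤Δ : 1ʳ ⊑ Δʳ
      1≤Δ = ι-mono-⊑ (≡.subst (λ k → 1ℚ ℚ.≤ fromℕ k) (≡.sym Δ≡1+k)
        (fromℕ-mono-≤ {1} {suc k} (ℕ.s≤s ℕ.z≤n)))

      open Extremal (0<p⇒ιp⋢0 0<Δ) (≃-trans (≃-sym (∣z∣²≃∥z∥² μ)) (⊗-cong ∣μ∣≃Δ ∣μ∣≃Δ))

      ¬¬everywhere : ¬ ¬ (∀ s → Maximal s × ¬ ∥ v s ∥² ⊑ 0ʳ)
      ¬¬everywhere = ¬¬extremal-everywhere connected (v≢0⇒¬v≋0 v v≢0)

      regular : Regular maxDegree
      -- Equality of natural numbers is decidable, which removes the double negation.
      regular s = decidable-stable (degree s ℕ.≟ maxDegree) λ k →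
        ¬¬everywhere λ h → k (degree≡Δ (proj₁ (h s)) (proj₂ (h s)))

      -- As μ is Δ or −Δ whenever G has an edge, one approximation of μ settles which.
      balanced : Eventually (λ n → seq (re μ) n ℚ.≤ ½)
                 ⊎ (∃[ q ] 0ℚ ℚ.< q × Eventually (λ n → q ℚ.≤ seq (re μ) n)) →
                 Balanced ⊎ GainGraph.Balanced (-ᵍ Φ)
      balanced (inj₁ small) = inj₂ (Balanced-stable (-ᵍ Φ) λ k → ¬¬everywhere λ h →
        k (Gain.harmonic⇒balanced (-ᵍ Φ) v (λ s → proj₂ (h s)) (Everywhere.-harmonic h Δ-μ⋢0)))
        where
        open ⊑-Reasoning
        Δ-μ⋢0 : ¬ Δʳ ⊝ re μ ⊑ 0ʳ
        Δ-μ⋢0 Δ-μ⊑0 = positive⇒¬⊑0 (ℚ.positive⁻¹ ½) (begin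
          ι ½             ≈⟨ solve 0 (con ½ := con 1ℚ :- con ½) ≃-refl ⟩
          1ʳ ⊝ ι ½        ≤⟨ ⊕-mono-⊑ 1≤Δ (⊖-anti-⊑ (eventually-⊑ small)) ⟩
          Δʳ ⊝ re μ       ∎) Δ-μ⊑0
      balanced (inj₂ (q , 0<q , q≤μ)) = inj₁ (Balanced-stable Φ λ k → ¬¬everywhere λ h →
        k (Gain.harmonic⇒balanced Φ v (λ s → proj₂ (h s)) (Everywhere.harmonic h Δ+μ⋢0)))
        where
        open ⊑-Reasoning
        Δ+μ⋢0 : ¬ Δʳ ⊕ re μ ⊑ 0ʳ
        Δ+μ⋢0 = positive⇒¬⊑0 0<q (begin
          ι q             ≤⟨ eventually-⊒ q≤μ ⟩
          re μ            ≈⟨ ⊕-identityˡ (re μ) ⟨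
          0ʳ ⊕ re μ       ≤⟨ ⊕-mono-⊑ (ι-mono-⊑ (ℚ.<⇒≤ 0<Δ)) ⊑-refl ⟩
          Δʳ ⊕ re μ       ∎)

  eigenvalue-bound : ∀ μ → IsEigenvalue (A Φ) μ → ∣ μ ∣ᶜ ⊑ Δʳ
  eigenvalue-bound μ (v , v≢0 , Av≈μv) =
    Eigenvector.∣μ∣⊑Δ μ v (∑-eigen (A Φ) μ v Av≈μv) (vertex G connected) (v≢0⇒¬v≋0 v v≢0)

  maximal-eigenvalue : ∀ μ v → ¬ (∀ s → v s ≋ cx 0ʳ) →
    (∀ s → ℂ∑.sum (λ t → A Φ s t ⊠ v t) ≋ μ ⊠ v s) → ∥ μ ∥² ≃ Δʳ ⊗ Δʳ →
    ∃[ μ ] IsEigenvalue (A Φ) μ × ∣ μ ∣ᶜ ≃ Δʳ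
  maximal-eigenvalue μ v v≢0 Av≋μv ∥μ∥²≃Δ² =
      μ
    , (v , (λ v≈0 → v≢0 λ s → ≡.subst (v s ≋_) 0ᶜ≡cx0 (≈ᶜ⇒≋ {v s} {0ᶜ} (v≈0 s)))
         , ∑-eigen⁻¹ (A Φ) μ v Av≋μv)
    , ⊑-antisym
        (square-cancel-⊑ (ι-mono-⊑ (fromℕ-nonNeg maxDegree)) (≃⇒⊑ ∣μ∣²≃Δ²))
        (square-cancel-⊑ (∣z∣-nonNeg μ) (≃⇒⊒ ∣μ∣²≃Δ²))
    where
    ∣μ∣²≃Δ² : ∣ μ ∣ᶜ ⊗ ∣ μ ∣ᶜ ≃ Δʳ ⊗ Δʳ
    ∣μ∣²≃Δ² = ≃-trans (∣z∣²≃∥z∥² μ) ∥μ∥²≃Δ²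

  -- The eigenvalue is `Δ κ`, of modulus Δ because `κ` has modulus 1. The vertex with value 1 shows
  -- that `v` is not 0.
  harmonic⇒eigenvalue : ∀ κ v → ∥ κ ∥² ≃ 1ʳ → (∃[ s ] v s ≋ cx 1ʳ) →
    (∀ {s t} (e : s ~ t) → φ s t e ⊠ v t ≋ κ ⊠ v s) → Regular maxDegree →
    ∃[ μ ] IsEigenvalue (A Φ) μ × ∣ μ ∣ᶜ ≃ Δʳ
  harmonic⇒eigenvalue κ v ∥κ∥²≃1 (s₀ , v≋1) φv≋κv regular =
    maximal-eigenvalue (cx Δʳ ⊠ κ) v
      (λ v≋0 → 0<p⇒ιp⋢0 (ℚ.positive⁻¹ 1ℚ)
        (≃⇒⊑ (_≋_.re-≃ (≋-trans (≋-sym v≋1) (v≋0 s₀)))))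
      (λ s → regular⇒eigen κ v φv≋κv (regular s))
      (begin
        ∥ cx Δʳ ⊠ κ ∥²              ≈⟨ ∥∥²-⊠ (cx Δʳ) κ ⟩
        ∥ cx Δʳ ∥² ⊗ ∥ κ ∥²         ≈⟨ ⊗-congˡ ∥κ∥²≃1 ⟩
        ∥ cx Δʳ ∥² ⊗ 1ʳ             ≈⟨ solve 1 (λ c → (c :* c :+ con 0ℚ :* con 0ℚ) :* con 1ℚ := c :* c)
                                         ≃-refl Δʳ ⟩
        Δʳ ⊗ Δʳ                     ∎)
    where open import Relation.Binary.Reasoning.Setoid ℝ-setoid

  balanced⇒eigenvalue : Regular maxDegree → Balanced ⊎ GainGraph.Balanced (-ᵍ Φ) →
                        ∃[ μ ] IsEigenvalue (A Φ) μ × ∣ μ ∣ᶜ ≃ Δʳ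
  balanced⇒eigenvalue regular (inj₁ balanced) =
    let v , harmonic , v₀≋1 = Gain.balanced⇒harmonic Φ (proj₂ connected) (vertex G connected) balanced
    in harmonic⇒eigenvalue (cx 1ʳ) v
         (solve 0 (con 1ℚ :* con 1ℚ :+ con 0ℚ :* con 0ℚ := con 1ℚ) ≃-refl) v₀≋1
         (λ {s} e → ≋-trans (harmonic e) (≋-sym (ℂᵣ.*-identityˡ (v s)))) regular
  balanced⇒eigenvalue regular (inj₂ balanced) =
    let v , harmonic , v₀≋1 = Gain.balanced⇒harmonic (-ᵍ Φ) (proj₂ connected) (vertex G connected)
                                balanced
    -- Balance of `-ᵍ Φ` gives `−φ_st v_t = v_s`, hence `κ = −1` and the eigenvalue -Δ.
    in harmonic⇒eigenvalue (⊟ cx 1ʳ) v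
         (solve 0 (:- con 1ℚ :* :- con 1ℚ :+ :- con 0ℚ :* :- con 0ℚ := con 1ℚ) ≃-refl) v₀≋1
         (λ {s} {t} e → ≋-trans (⊟1⊠⊟z⊠w (φ s t e) (v t)) (⊠-cong ≋-refl
           (≡.subst (λ a → a ⊠ v t ≋ v s) (-ᶜ≡⊟ (φ s t e)) (harmonic e)))) regular
    where
    ⊟1⊠⊟z⊠w : ∀ z w → z ⊠ w ≋ ⊟ cx 1ʳ ⊠ (⊟ z ⊠ w)
    ⊟1⊠⊟z⊠w (a +i b) (c +i d) = mk
      (solve 4 (λ a b c d → a :* c :- b :* d :=
        :- con 1ℚ :* (:- a :* c :- :- b :* d) :- :- con 0ℚ :* (:- a :* d :+ :- b :* c))
        ≃-refl a b c d)
      (solve 4 (λ a b c d → a :* d :+ b :* c :=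
        :- con 1ℚ :* (:- a :* d :+ :- b :* c) :+ :- con 0ℚ :* (:- a :* c :- :- b :* d))
        ≃-refl a b c d)

theorem5p3 : (n : ℕ) (G : Graph n) (Φ : GainGraph G) → Graph.Connected G →
    let Δ = Graph.maxDegree G in
    IsSpectralRadius (GainGraph.A Φ) (fromℚ (fromℕ Δ)) ⇔
    (Graph.Regular G Δ × (GainGraph.Balanced Φ ⊎ GainGraph.Balanced (-ᵍ Φ)))
theorem5p3 n G Φ connected = mk⇔
  (λ ((μ , eigen , ∣μ∣≈Δ) , _) →
    extremal⇒regular-balanced Φ connected μ eigen (≡.subst (∣ μ ∣ᶜ ≃_) Δ≡ (mk ∣μ∣≈Δ)))
  (λ (regular , balanced) →
    (let μ , eigen , ∣μ∣≃Δ = balanced⇒eigenvalue Φ connected regular balanced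
     in μ , eigen , _≃_.raw (≡.subst (∣ μ ∣ᶜ ≃_) (≡.sym Δ≡) ∣μ∣≃Δ))
    , λ μ eigen → _⊑_.raw (≡.subst (∣ μ ∣ᶜ ⊑_) (≡.sym Δ≡) (eigenvalue-bound Φ connected μ eigen)))
  where
  Δ≡ : fromℚ (fromℕ (Graph.maxDegree G)) ≡ ι (fromℕ (Graph.maxDegree G))
  Δ≡ = fromℚ≡ι (fromℕ (Graph.maxDegree G))
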